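{- Let $m,k\geq 3$ be integers, and let $C(m,k)$ be the caterpillar with spine $v_1v_2\dots v_m$ in which every inner spine vertex has degree $k$. Then $$hc(C(m,k))=\begin{cases}(m-2)^2k^2-\frac12(5m^2-20m+19)k+\frac12(3m^2-12m+11), & \text{if } m\text{ is odd},\\[4pt] (m-2)^2k^2-\frac12(5m^2-20m+20)k+\frac12(3m^2-12m+12), & \text{if } m\text{ is even}.\end{cases}$$
   Context: For a connected graph $G$ of order $n$ (finite, simple), $D(u,v)$ denotes the detour distance between vertices $u,v$, i.e. the length of a longest $u,v$-path in $G$ (for a tree this is the ordinary distance). A hamiltonian coloring of $G$ is a map $c: V(G)\to\{0,1,2,\dots\}$ such that $D(u,v)+|c(u)-c(v)|\geq n-1$ for every two distinct vertices $u,v$. The value $hc(c)$ is the maximum color assigned by $c$, and the hamiltonian chromatic number $hc(G)$ is the minimum of $hc(c)$ over all hamiltonian colorings $c$ of $G$ (note that the color $0$ is allowed). A caterpillar is a tree consisting of a path $v_1v_2\dots v_m$ ($m\geq 3$), called the spine, together with some hanging (pendant) edges, called legs, incident to the inner vertices $v_2,\dots,v_{m-1}$. If every $v_i$ with $2\leq i\leq m-1$ has degree $k$ (so exactly $k-2$ pendant vertices are attached to each inner spine vertex), the caterpillar is denoted $C(m,k)$. -}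

module Defs where

open import Data.Fin using (Fin; toℕ; fromℕ<)
open import Data.Fin.Properties using (toℕ<n; toℕ-fromℕ<; toℕ-injective; +↔⊎; *↔×)
open import Data.List using (List; []; _∷_; map; allFin)
open import Data.List.Extrema.Nat using (max)
open import Data.List.Relation.Unary.Unique.Propositional using (Unique)
open import Data.Nat using (ℕ; zero; suc; _+_; _*_; _∸_; _≤_; _<_; ∣_-_∣)
open import Data.Nat.Properties using (1+n≢n; <-trans; n<1+n; m<n⇒0<n; ≰⇒>; <⇒≱; m≤n⇒m≤1+n; m≤n+o⇒m∸n≤o)
open import Data.Product using (_×_; _,_; ∃-syntax)
open import Data.Sum using (_⊎_; inj₁; inj₂)
open import Data.Sum.Function.Propositional using (_⊎-↔_)
open import Function using (_∘_)
open import Function.Bundles using (_↔_; Inverse)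
open import Function.Construct.Composition using (_↔-∘_)
open import Function.Construct.Identity using (↔-id)
open import Function.Construct.Symmetry using (↔-sym)
open import Relation.Binary.Construct.Closure.ReflexiveTransitive using (Star; ε; _◅_; _◅◅_) renaming (reverse to reverseWalk)
open import Relation.Binary.Construct.Closure.Symmetric using (SymClosure; fwd; bwd; symmetric)
open import Relation.Binary.Definitions using (Symmetric)
open import Relation.Binary.PropositionalEquality using (_≡_; _≢_; refl; sym; trans; cong; subst)
open import Relation.Nullary using (¬_)

IsMaximum : (ℕ → Set) → ℕ → Set
IsMaximum P x = P x × (∀ y → P y → y ≤ x)

IsMinimum : (ℕ → Set) → ℕ → Set
IsMinimum P x = P x × (∀ y → P y → x ≤ y)

record ConnectedGraph : Set₁ where
  field
    Vertex    : Set
    order     : ℕ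
    enum      : Fin order ↔ Vertex
    Adj       : Vertex → Vertex → Set
    Adj-sym   : Symmetric Adj
    Adj-irrefl : ∀ {v} → ¬ Adj v v
    connected : ∀ u v → Star Adj u v

module _ (G : ConnectedGraph) where
  open ConnectedGraph G

  Walk : Vertex → Vertex → Set
  Walk = Star Adj

  length : ∀ {u v} → Walk u v → ℕ
  length ε       = 0
  length (_ ◅ p) = suc (length p)

  vertices : ∀ {u v} → Walk u v → List Vertex
  vertices {u} ε       = u ∷ []
  vertices {u} (_ ◅ p) = u ∷ vertices p

  IsPath : ∀ {u v} → Walk u v → Set
  IsPath p = Unique (vertices p)

  IsDetourDistance : Vertex → Vertex → ℕ → Set
  IsDetourDistance u v =
    IsMaximum (λ d → ∃[ p ] IsPath {u} {v} p × length p ≡ d)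

  -- The detour distance is a relation rather than a function; the existential
  -- (as opposed to "for every D") keeps the condition from holding vacuously.
  IsHamiltonianColoring : (Vertex → ℕ) → Set
  IsHamiltonianColoring c = ∀ u v → u ≢ v →
    ∃[ D ] IsDetourDistance u v D × order ∸ 1 ≤ D + ∣ c u - c v ∣

  -- The base value 0 only matters for the graph without vertices.
  maxColor : (Vertex → ℕ) → ℕ
  maxColor c = max 0 (map (c ∘ Inverse.to enum) (allFin order))

  IsHamiltonianChromaticNumber : ℕ → Set
  IsHamiltonianChromaticNumber =
    IsMinimum (λ s → ∃[ c ] IsHamiltonianColoring c × maxColor c ≡ s)

module Caterpillar (m k : ℕ) where

  -- inj₁ i is the spine vertex v_{i+1}; inj₂ (p , q) is the q-th of the
  -- k - 2 pendant vertices at the inner spine vertex v_{p+2}.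
  V : Set
  V = Fin m ⊎ (Fin (m ∸ 2) × Fin (k ∸ 2))

  data Edge : V → V → Set where
    spine : ∀ {i j} → toℕ j ≡ suc (toℕ i) → Edge (inj₁ i) (inj₁ j)
    leg   : ∀ {i p q} → toℕ i ≡ suc (toℕ p) → Edge (inj₁ i) (inj₂ (p , q))

  Adj : V → V → Set
  Adj = SymClosure Edge

  Edge-irrefl : ∀ {v} → ¬ Edge v v
  Edge-irrefl (spine eq) = 1+n≢n (sym eq)

  Adj-irrefl : ∀ {v} → ¬ Adj v v
  Adj-irrefl (fwd e) = Edge-irrefl e
  Adj-irrefl (bwd e) = Edge-irrefl e

  private
    inner : ∀ {p} → p < m ∸ 2 → suc p < m
    inner p<m∸2 = ≰⇒> λ m≤1+p →
      <⇒≱ p<m∸2 (m≤n+o⇒m∸n≤o m 2 (m≤n⇒m≤1+n m≤1+p))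

    start : ∀ a (i j : Fin m) → toℕ i ≡ 0 → toℕ j ≡ a → Star Adj (inj₁ i) (inj₁ j)
    start zero i j i≡0 j≡0 with toℕ-injective (trans i≡0 (sym j≡0))
    ... | refl = ε
    start (suc a) i j i≡0 j≡1+a = start a i j′ i≡0 (toℕ-fromℕ< a<m)
      ◅◅ (fwd (spine (trans j≡1+a (cong suc (sym (toℕ-fromℕ< a<m))))) ◅ ε)
      where
      a<m : a < m
      a<m = <-trans (n<1+n a) (subst (_< m) j≡1+a (toℕ<n j))
      j′ = fromℕ< a<m

    fromZero : ∀ (i : Fin m) → toℕ i ≡ 0 → ∀ v → Star Adj (inj₁ i) v
    fromZero i i≡0 (inj₁ j) = start (toℕ j) i j i≡0 refl
    fromZero i i≡0 (inj₂ (p , q)) = start (suc (toℕ p)) i j i≡0 (toℕ-fromℕ< lt)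
      ◅◅ (fwd (leg (toℕ-fromℕ< lt)) ◅ ε)
      where
      lt = inner (toℕ<n p)
      j  = fromℕ< lt

    0<m : V → 0 < m
    0<m (inj₁ i)       = m<n⇒0<n (toℕ<n i)
    0<m (inj₂ (p , _)) = m<n⇒0<n (inner (toℕ<n p))

  connected : ∀ u v → Star Adj u v
  connected u v = reverseWalk (symmetric Edge) (fromZero o o≡0 u) ◅◅ fromZero o o≡0 v
    where
    o   = fromℕ< (0<m u)
    o≡0 = toℕ-fromℕ< (0<m u)

C : ℕ → ℕ → ConnectedGraph
C m k = record
  { Vertex     = V
  ; order      = m + (m ∸ 2) * (k ∸ 2)
  ; enum       = (↔-id _ ⊎-↔ *↔×) ↔-∘ +↔⊎
  ; Adj        = Adj
  ; Adj-sym    = symmetric Edge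
  ; Adj-irrefl = Adj-irrefl
  ; connected  = connected
  }
  where open Caterpillar m k

module Submission where

-- Write N = n - 1. Every path of a tree between two given vertices has the
-- same length, so D is the tree distance d. Let wt v be twice the distance of
-- v from the middle of the spine (a midpoint of an edge when m is even). Then
-- 2 d(u,v) ≤ wt u + wt v, with equality when u and v lie on opposite sides of
-- the middle.
--
-- List the vertices by increasing color x₀, …, x_N. Adding up
-- c(xᵢ₊₁) - c(xᵢ) ≥ N - d(xᵢ,xᵢ₊₁) gives
-- max c ≥ N² - Σ wt + (wt x₀ + wt x_N)/2, where wt x₀ + wt x_N ≥ 2 d(x₀,x_N) ≥ 2.
--
-- Conversely, for any ordering of the vertices the partial sums of the gaps
-- N - d(xᵢ,xᵢ₊₁) form a hamiltonian coloring, because two gaps are at least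
-- N - 1. It attains the bound if the ordering alternates between the two
-- sides, starting and ending at two adjacent middle vertices. Alternation is
-- obtained from the reflection of the spine: each vertex of the lower side is
-- listed right after its mirror image.

open import Defs
open import Data.Nat using (ℕ)

-- Detour distances in trees

module DetourDistance (G : ConnectedGraph) where
  open ConnectedGraph G
  open import Data.List.Relation.Unary.All as All using (All; []; _∷_)
  open import Data.List.Relation.Unary.AllPairs using ([]; _∷_)
  open import Data.Nat using (ℕ; suc; _≤_)
  open import Data.Nat.Properties
    using (suc-injective; ≤-refl; ≤-reflexive; ≤-trans; ≤-<-trans; m≤n⇒m≤1+n; n≮n)
  open import Data.Product using (_,_; ∃-syntax)
  open import Data.Sum using (_⊎_; inj₁; inj₂)
  open import Relation.Binary.Construct.Closure.ReflexiveTransitive using (ε; _◅_)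
  open import Relation.Binary.Definitions using (DecidableEquality)
  open import Relation.Binary.PropositionalEquality using (_≡_; _≢_; refl; sym; trans; cong)
  open import Relation.Nullary using (¬_; yes; no; contradiction)

  -- Satisfied only by trees, where it makes f the distance to v.
  record IsTreeDistance (v : Vertex) (f : Vertex → ℕ) : Set where
    field
      root          : f v ≡ 0
      step          : ∀ {x y} → Adj x y → f x ≡ suc (f y) ⊎ f y ≡ suc (f x)
      parent-unique : ∀ {x y z} → Adj x y → Adj x z →
                      f x ≡ suc (f y) → f x ≡ suc (f z) → y ≡ z

  All-start : ∀ {P : Vertex → Set} {x y} (p : Walk G x y) → All P (vertices G p) → P x
  All-start ε       (px ∷ _) = px
  All-start (_ ◅ _) (px ∷ _) = px

  module _ {v f} (T : IsTreeDistance v f) where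
    open IsTreeDistance T

    -- A path that has left its parent behind can only climb, so it never
    -- returns to the root.
    no-return : ∀ {x y} (p : Walk G x v) → IsPath G p → Adj x y → f x ≡ suc (f y) →
                ¬ All (y ≢_) (vertices G p)
    no-return ε _ _ fx≡1+fy _ = contradiction (trans (sym root) fx≡1+fy) λ ()
    no-return (e ◅ p) (x∉p ∷ p!) a fx≡1+fy (_ ∷ y∉p) with step e
    ... | inj₁ fx≡1+fz = All-start p y∉p (parent-unique a e fx≡1+fy fx≡1+fz)
    ... | inj₂ fz≡1+fx = no-return p p! (Adj-sym e) fz≡1+fx x∉p

    -- If the first step climbed, the rest of the path would by `no-return` have to pass through `x`
    -- again, which a path cannot do. So every step descends and the length is forced.
    path-length : ∀ {x} (p : Walk G x v) → IsPath G p → length G p ≡ f x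
    path-length ε _ = sym root
    path-length (e ◅ p) (x∉p ∷ p!) with step e
    ... | inj₁ fx≡1+fz = trans (cong suc (path-length p p!)) (sym fx≡1+fz)
    ... | inj₂ fz≡1+fx = contradiction x∉p (no-return p p! (Adj-sym e) fz≡1+fx)

    -- Needed by `walk⇒path`: a vertex strictly above the start of a path to `v` cannot lie on that
    -- path, so it may be prepended.
    path-below : ∀ {x} (p : Walk G x v) → IsPath G p → All (λ y → f y ≤ f x) (vertices G p)
    path-below ε       _ = ≤-refl ∷ []
    path-below (e ◅ p) (x∉p ∷ p!) with step e
    ... | inj₁ fx≡1+fz = ≤-refl ∷ All.map
            (λ fy≤fz → ≤-trans (m≤n⇒m≤1+n fy≤fz) (≤-reflexive (sym fx≡1+fz))) (path-below p p!)
    ... | inj₂ fz≡1+fx = contradiction x∉p (no-return p p! (Adj-sym e) fz≡1+fx)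

    -- If the walk steps away from the root, then the path obtained from its
    -- tail must immediately come back, and that detour is dropped.
    walk⇒path : ∀ {x} → Walk G x v → ∃[ p ] IsPath G {x} {v} p
    walk⇒path ε = ε , [] ∷ []
    walk⇒path {x} (e ◅ w) with walk⇒path w | step e
    ... | p , p! | inj₁ fx≡1+fz = e ◅ p , All.map fresh (path-below p p!) ∷ p!
      where
      fresh : ∀ {y} → f y ≤ _ → x ≢ y
      fresh fy≤fz refl = n≮n _ (≤-<-trans fy≤fz (≤-reflexive (sym fx≡1+fz)))
    ... | ε , _ | inj₂ fv≡1+fx = contradiction (trans (sym root) fv≡1+fx) λ ()
    ... | e′ ◅ q , p!@(_ ∷ q!) | inj₂ fz≡1+fx
      with refl ← parent-unique (Adj-sym e) e′ fz≡1+fx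
                    (trans (sym (path-length (e′ ◅ q) p!)) (cong suc (path-length q q!)))
      = q , q!

    isDetourDistance : ∀ x → IsDetourDistance G x v (f x)
    isDetourDistance x with p , p! ← walk⇒path (connected x v) =
      (p , p! , path-length p p!) , λ { _ (q , q! , refl) → ≤-reflexive (path-length q q!) }

    detourDistance-unique : ∀ {x D} → IsDetourDistance G x v D → D ≡ f x
    detourDistance-unique ((p , p! , refl) , _) = path-length p p!

  module _ (_≟_ : DecidableEquality Vertex) where

    leafDistance : Vertex → (Vertex → ℕ) → Vertex → ℕ
    leafDistance v f x with x ≟ v
    ... | yes _ = 0
    ... | no  _ = suc (f x)

    leafDistance-≢ : ∀ {v x} f → x ≢ v → leafDistance v f x ≡ suc (f x)
    leafDistance-≢ {v} {x} f x≢v with x ≟ v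
    ... | yes x≡v = contradiction x≡v x≢v
    ... | no  _   = refl

    -- A leaf `v` is reached only through `w`, so distances to `w` grow by one everywhere except at
    -- `v` itself. An edge at `v` has `w` as its other end, where `f` vanishes. A vertex with parent
    -- `v` has no second parent, since `v` has value `0` and every other vertex at least `1`.
    isTreeDistance-leaf : ∀ {v w f} → IsTreeDistance w f → (∀ {y} → Adj v y → y ≡ w) →
                          IsTreeDistance v (leafDistance v f)
    isTreeDistance-leaf {v} {w} {f} T v-leaf = record
      { root = root′ ; step = step′ ; parent-unique = parent-unique′ }
      where
      open IsTreeDistance T
      root′ : leafDistance v f v ≡ 0
      root′ with v ≟ v
      ... | yes _   = refl
      ... | no  v≢v = contradiction refl v≢v
      step′ : ∀ {x y} → Adj x y → leafDistance v f x ≡ suc (leafDistance v f y)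
                                ⊎ leafDistance v f y ≡ suc (leafDistance v f x)
      step′ {x} {y} a with x ≟ v | y ≟ v
      ... | yes refl | yes refl = contradiction a Adj-irrefl
      ... | yes refl | no  _ with refl ← v-leaf a = inj₂ (cong suc root)
      step′ {x} {y} a | no _ | yes refl with refl ← v-leaf (Adj-sym a) = inj₁ (cong suc root)
      step′ {x} {y} a | no _ | no _ with step a
      ... | inj₁ eq = inj₁ (cong suc eq)
      ... | inj₂ eq = inj₂ (cong suc eq)
      parent-unique′ : ∀ {x y z} → Adj x y → Adj x z →
        leafDistance v f x ≡ suc (leafDistance v f y) →
        leafDistance v f x ≡ suc (leafDistance v f z) → y ≡ z
      parent-unique′ {x} {y} {z} a b p q with x ≟ v | y ≟ v | z ≟ v
      ... | yes _ | _        | _        = contradiction p λ ()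
      ... | no _  | yes refl | yes refl = refl
      ... | no _  | no _     | no _     = parent-unique a b (suc-injective p) (suc-injective q)
      ... | no _  | yes _    | no _     = contradiction (trans (sym p) q) λ ()
      ... | no _  | no _     | yes _    = contradiction (trans (sym q) p) λ ()

-- Distances in the caterpillar with `2 + t` spine vertices and `l` legs per inner vertex

module CaterpillarDistance (t l : ℕ) where
  open import Data.Empty using (⊥-elim)
  open import Data.Fin as Fin using (Fin; toℕ)
  open import Data.Fin.Properties as Fin using (toℕ-injective)
  open import Data.Nat using (ℕ; zero; suc; _+_; _≤_; _<_; s≤s; z≤n; ∣_-_∣)
  open import Data.Nat.Properties
  open import Algebra.Properties.CommutativeSemigroup +-commutativeSemigroup using (x∙yz≈y∙xz)
  open import Data.Product using (_×_; _,_; ∃-syntax)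
  import Data.Product.Properties as Product
  open import Data.Sum using (_⊎_; inj₁; inj₂)
  import Data.Sum as Sum
  import Data.Sum.Properties as Sum
  open import Relation.Binary.Construct.Closure.Symmetric using (fwd; bwd)
  open import Relation.Binary.Definitions using (DecidableEquality)
  open import Relation.Binary.PropositionalEquality using (_≡_; _≢_; refl; sym; trans; cong; subst)
  open import Relation.Nullary using (contradiction)

  open Caterpillar (2 + t) (2 + l) public
  open DetourDistance (C (2 + t) (2 + l))

  infix 4 _≟V_
  _≟V_ : DecidableEquality V
  _≟V_ = Sum.≡-dec Fin._≟_ (Product.≡-dec Fin._≟_ Fin._≟_)

  pos : V → ℕ
  pos (inj₁ i)       = toℕ i
  pos (inj₂ (p , _)) = suc (toℕ p)

  ht : V → ℕ
  ht (inj₁ _) = 0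
  ht (inj₂ _) = 1

  -- The distance of u and v unless they are the same leg: then this is 2.
  dist : V → V → ℕ
  dist u v = ht v + (ht u + ∣ pos u - pos v ∣)

  dist-comm : ∀ u v → dist u v ≡ dist v u
  dist-comm u v rewrite ∣-∣-comm (pos u) (pos v) =
    x∙yz≈y∙xz (ht v) (ht u) ∣ pos v - pos u ∣

  1≤dist : ∀ {u v} → u ≢ v → 1 ≤ dist u v
  1≤dist {inj₁ i} {inj₁ j} u≢v =
    m≢n⇒1≤∣m-n∣ λ i≡j → u≢v (cong inj₁ (toℕ-injective i≡j))
    where
    m≢n⇒1≤∣m-n∣ : ∀ {m n} → m ≢ n → 1 ≤ ∣ m - n ∣
    m≢n⇒1≤∣m-n∣ m≢n = n≢0⇒n>0 λ eq → m≢n (∣m-n∣≡0⇒m≡n eq)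
  1≤dist {inj₁ _} {inj₂ _} _ = s≤s z≤n
  1≤dist {inj₂ _} {inj₁ _} _ = s≤s z≤n
  1≤dist {inj₂ _} {inj₂ _} _ = s≤s z≤n

  -- The order of `m` and `n` is returned together with the change of distance, so that the
  -- direction towards `n` can be recovered from distances alone.
  ∣-∣-step : ∀ m n → (m < n × ∣ m - n ∣ ≡ suc ∣ suc m - n ∣)
                   ⊎ (n ≤ m × ∣ suc m - n ∣ ≡ suc ∣ m - n ∣)
  ∣-∣-step zero    zero    = inj₂ (z≤n , refl)
  ∣-∣-step (suc m) zero    = inj₂ (z≤n , refl)
  ∣-∣-step zero    (suc n) = inj₁ (s≤s z≤n , refl)
  ∣-∣-step (suc m) (suc n) with ∣-∣-step m n
  ... | inj₁ (m<n , eq) = inj₁ (s≤s m<n , eq)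
  ... | inj₂ (n≤m , eq) = inj₂ (s≤s n≤m , eq)

  private
    n≢2+n : ∀ {n} → n ≢ suc (suc n)
    n≢2+n {suc n} eq = n≢2+n (suc-injective eq)

  ascending : ∀ {m n} → ∣ m - n ∣ ≡ suc ∣ suc m - n ∣ → m < n
  ascending {m} {n} eq with ∣-∣-step m n
  ... | inj₁ (m<n , _) = m<n
  ... | inj₂ (_ , eq′) = ⊥-elim (n≢2+n (trans eq (cong suc eq′)))

  descending : ∀ {m n} → ∣ suc m - n ∣ ≡ suc ∣ m - n ∣ → n ≤ m
  descending {m} {n} eq with ∣-∣-step m n
  ... | inj₂ (n≤m , _) = n≤m
  ... | inj₁ (_ , eq′) = ⊥-elim (n≢2+n (trans eq (cong suc eq′)))

  -- A leg is farther from `i` than its spine vertex, so it is never a parent. Two spine neighbours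
  -- of a vertex cannot both be closer: `i` would lie strictly to the right of that vertex and also
  -- not to the right of it.
  isTreeDistance-spine : ∀ i → IsTreeDistance (inj₁ i) (λ x → dist x (inj₁ i))
  isTreeDistance-spine i = record
    { root = ∣n-n∣≡0 (toℕ i)
    ; step = λ { (fwd e) → Sum.swap (edge e) ; (bwd e) → edge e }
    ; parent-unique = unique
    }
    where
    r : ℕ
    r = toℕ i
    f : V → ℕ
    f x = dist x (inj₁ i)
    edge : ∀ {x y} → Edge x y → f y ≡ suc (f x) ⊎ f x ≡ suc (f y)
    edge (spine {a} b≡1+a) rewrite b≡1+a with ∣-∣-step (toℕ a) r
    ... | inj₁ (_ , eq) = inj₂ eq
    ... | inj₂ (_ , eq) = inj₁ eq
    edge (leg a≡1+p) rewrite a≡1+p = inj₁ refl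
    descending′ : ∀ {a b} → a ≡ suc b → ∣ a - r ∣ ≡ suc ∣ b - r ∣ → r ≤ a
    descending′ refl eq = m≤n⇒m≤1+n (descending eq)
    unique : ∀ {x y z} → Adj x y → Adj x z → f x ≡ suc (f y) → f x ≡ suc (f z) → y ≡ z
    unique (fwd (leg eq)) _ p _ rewrite eq = ⊥-elim (n≢2+n p)
    unique _ (fwd (leg eq)) _ q rewrite eq = ⊥-elim (n≢2+n q)
    unique (fwd (spine y≡)) (fwd (spine z≡)) _ _ = cong inj₁ (toℕ-injective (trans y≡ (sym z≡)))
    unique {inj₁ a} (fwd (spine y≡)) (bwd (spine x≡)) p q rewrite y≡ =
      contradiction (ascending {toℕ a} p) (≤⇒≯ (descending′ {toℕ a} x≡ q))
    unique {inj₁ a} (bwd (spine x≡)) (fwd (spine z≡)) p q rewrite z≡ =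
      contradiction (ascending {toℕ a} q) (≤⇒≯ (descending′ {toℕ a} x≡ p))
    unique (bwd (spine x≡)) (bwd (spine x≡′)) _ _ =
      cong inj₁ (toℕ-injective (suc-injective (trans (sym x≡) x≡′)))
    unique (bwd (leg y≡)) (bwd (leg z≡)) _ _ = cong inj₁ (toℕ-injective (trans y≡ (sym z≡)))

  attachment : Fin t → Fin (2 + t)
  attachment p = Fin.suc (Fin.inject₁ p)

  toℕ-attachment : ∀ p → toℕ (attachment p) ≡ suc (toℕ p)
  toℕ-attachment p = cong suc (Fin.toℕ-inject₁ p)

  leg-neighbour : ∀ {p q y} → Adj (inj₂ (p , q)) y → y ≡ inj₁ (attachment p)
  leg-neighbour {p} (bwd (leg y≡)) = cong inj₁ (toℕ-injective (trans y≡ (sym (toℕ-attachment p))))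

  -- A leg is a leaf, so its case reduces to the spine vertex that carries it. Agreement with `dist`
  -- is limited to `u ≢ v` because `dist` of a leg to itself is `2`.
  treeDistance : ∀ v → ∃[ f ] IsTreeDistance v f × (∀ {u} → u ≢ v → f u ≡ dist u v)
  treeDistance (inj₁ i) = _ , isTreeDistance-spine i , λ _ → refl
  treeDistance v@(inj₂ (p , q)) =
    _ , isTreeDistance-leaf _≟V_ (isTreeDistance-spine (attachment p)) leg-neighbour ,
    λ {u} u≢v → trans (leafDistance-≢ _≟V_ _ u≢v)
                       (cong (λ n → suc (ht u + ∣ pos u - n ∣)) (toℕ-attachment p))

  isDetourDistance-dist : ∀ {u v} → u ≢ v → IsDetourDistance (C (2 + t) (2 + l)) u v (dist u v)
  isDetourDistance-dist {u} {v} u≢v with f , T , f≡dist ← treeDistance v =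
    subst (IsDetourDistance _ u v) (f≡dist u≢v) (isDetourDistance T u)

  detourDistance⇒dist : ∀ {u v D} → u ≢ v → IsDetourDistance (C (2 + t) (2 + l)) u v D → D ≡ dist u v
  detourDistance⇒dist {u} {v} u≢v D-max with f , T , f≡dist ← treeDistance v =
    trans (detourDistance-unique T D-max) (f≡dist u≢v)

-- The largest color and the chromatic number

module MaxColor (G : ConnectedGraph) where
  open import Data.List using (map; allFin)
  open import Data.List.Extrema.Nat using (xs≤max; max≤v⁺)
  open import Data.List.Membership.Propositional using (_∈_)
  open import Data.List.Membership.Propositional.Properties using (∈-map⁺; ∈-allFin)
  open import Data.List.Relation.Unary.All as All using (All)
  import Data.List.Relation.Unary.All.Properties as All
  open import Data.Nat using (ℕ; _+_; _≤_; z≤n)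
  open import Data.Nat.Properties using (≤-antisym; ≤-trans; ≤-reflexive; +-cancelˡ-≤)
  open import Data.Product using (_×_; _,_; ∃-syntax)
  open import Function using (_∘_)
  open import Function.Bundles using (Inverse)
  open import Relation.Binary.PropositionalEquality using (_≡_; refl; cong; subst)
  open ConnectedGraph G using (Vertex; order; enum)
  open Inverse enum using (to; from; inverseˡ)

  color≤maxColor : ∀ c v → c v ≤ maxColor G c
  color≤maxColor c v = All.lookup
    (xs≤max 0 (map (c ∘ to) (allFin order)))
    (subst (_∈ map (c ∘ to) (allFin order)) (cong c (inverseˡ refl))
      (∈-map⁺ (c ∘ to) (∈-allFin (from v))))

  maxColor≤ : ∀ c {h} → (∀ v → c v ≤ h) → maxColor G c ≤ h
  maxColor≤ c c≤h = max≤v⁺ z≤n (All.map⁺ (All.universal (λ i → c≤h (to i)) (allFin order)))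

  -- One coloring that meets a bound valid for all colorings is a minimum. `S` will be the total
  -- weight and `T` will be `N * N + 1`; adding `S` avoids truncated subtraction.
  chromaticNumber-from-bounds : ∀ S T (c : Vertex → ℕ) → IsHamiltonianColoring G c →
    S + maxColor G c ≤ T → (∀ c → IsHamiltonianColoring G c → T ≤ S + maxColor G c) →
    ∃[ h ] IsHamiltonianChromaticNumber G h × S + h ≡ T
  chromaticNumber-from-bounds S T c hc upper lower = maxColor G c , ((c , hc , refl) , minimal) , value
    where
    value : S + maxColor G c ≡ T
    value = ≤-antisym upper (lower c hc)
    minimal : ∀ y → (∃[ c′ ] IsHamiltonianColoring G c′ × maxColor G c′ ≡ y) → maxColor G c ≤ y
    minimal _ (c′ , hc′ , refl) = +-cancelˡ-≤ S _ _
      (≤-trans (≤-reflexive value) (lower c′ hc′))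

open MaxColor

-- Sums of distances from the middle of a spine

module FiniteSums where
  open import Data.Fin using (toℕ)
  open import Data.List as List
    using (List; []; _∷_; _++_; map; allFin; cartesianProduct; tabulate; applyUpTo)
  import Data.List.Properties as List
  open import Data.Nat using (ℕ; zero; suc; _+_; _*_; ∣_-_∣)
  open import Data.Nat.ListAction using (sum)
  open import Data.Nat.ListAction.Properties using (sum-++)
  open import Data.Nat.Properties
  open import Data.Nat.Tactic.RingSolver using (solve-∀)
  open import Data.Product using (_,_; proj₁)
  open import Function using (_∘_; id)
  open import Relation.Binary.PropositionalEquality
    using (_≡_; refl; sym; trans; cong; cong₂; module ≡-Reasoning)

  length-cartesianProduct : ∀ {A B : Set} (xs : List A) (ys : List B) →
    List.length (cartesianProduct xs ys) ≡ List.length xs * List.length ys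
  length-cartesianProduct []       ys = refl
  length-cartesianProduct (x ∷ xs) ys = trans
    (List.length-++ (map (x ,_) ys))
    (cong₂ _+_ (List.length-map (x ,_) ys) (length-cartesianProduct xs ys))

  length-allFin : ∀ n → List.length (allFin n) ≡ n
  length-allFin n = List.length-tabulate _

  -- Removing both ends of a spine with `2 + n` vertices keeps its middle, so the inner vertices
  -- keep their distance from it. This serves both the recursion for `spineSum` and the legs.
  ∣1+2[1+i]-2+n∣ : ∀ i n → ∣ suc (2 * suc i) - (2 + n) ∣ ≡ ∣ suc (2 * i) - n ∣
  ∣1+2[1+i]-2+n∣ i n = cong (λ j → ∣ suc j - (2 + n) ∣) (*-suc 2 i)

  -- Twice the total distance of `n` path vertices from the middle of the path. The value is the
  -- floor of `n * n / 2`, and this is where the parity of `m` enters the formula.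
  spineSum : ℕ → ℕ
  spineSum n = sum (applyUpTo (λ i → ∣ suc (2 * i) - n ∣) n)

  sum-allFin : ∀ n (f : ℕ → ℕ) → sum (map (f ∘ toℕ) (allFin n)) ≡ sum (applyUpTo f n)
  sum-allFin n f = cong sum (trans (List.map-tabulate id (f ∘ toℕ)) (tabulate-toℕ n f))
    where
    tabulate-toℕ : ∀ n (f : ℕ → ℕ) → tabulate {n = n} (f ∘ toℕ) ≡ applyUpTo f n
    tabulate-toℕ zero    f = refl
    tabulate-toℕ (suc n) f = cong (f 0 ∷_) (tabulate-toℕ n (f ∘ suc))

  sum-applyUpTo-cong : ∀ {f g : ℕ → ℕ} → (∀ i → f i ≡ g i) → ∀ n →
    sum (applyUpTo f n) ≡ sum (applyUpTo g n)
  sum-applyUpTo-cong f≗g zero    = refl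
  sum-applyUpTo-cong f≗g (suc n) = cong₂ _+_ (f≗g 0) (sum-applyUpTo-cong (f≗g ∘ suc) n)

  sum-applyUpTo-∷ʳ : ∀ f n → sum (applyUpTo f (suc n)) ≡ sum (applyUpTo f n) + f n
  sum-applyUpTo-∷ʳ f n = trans (cong sum (sym (List.applyUpTo-∷ʳ f n)))
    (trans (sum-++ (applyUpTo f n) (f n ∷ [])) (cong (sum (applyUpTo f n) +_) (+-identityʳ (f n))))

  sum-applyUpTo-const+ : ∀ k f n → sum (applyUpTo (λ i → k + f i) n) ≡ n * k + sum (applyUpTo f n)
  sum-applyUpTo-const+ k f zero    = refl
  sum-applyUpTo-const+ k f (suc n) = trans
    (cong (k + f 0 +_) (sum-applyUpTo-const+ k (f ∘ suc) n))
    (regroup k (f 0) (n * k) _)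
    where
    regroup : ∀ k a b c → k + a + (b + c) ≡ k + b + (a + c)
    regroup = solve-∀

  -- The two end vertices contribute `suc n` each; the rest is a spine of `n` vertices with the same
  -- middle.
  spineSum-2+ : ∀ n → spineSum (2 + n) ≡ spineSum n + 2 * suc n
  spineSum-2+ n = begin
    suc n + sum (applyUpTo (λ i → ∣ suc (2 * suc i) - (2 + n) ∣) (suc n))
      ≡⟨ cong (suc n +_) (sum-applyUpTo-cong (λ i → ∣1+2[1+i]-2+n∣ i n) (suc n)) ⟩
    suc n + sum (applyUpTo f (suc n))
      ≡⟨ cong (suc n +_) (sum-applyUpTo-∷ʳ f n) ⟩
    suc n + (spineSum n + f n)
      ≡⟨ cong (λ d → suc n + (spineSum n + d)) end ⟩
    suc n + (spineSum n + suc n)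
      ≡⟨ regroup n (spineSum n) ⟩
    spineSum n + 2 * suc n ∎
    where
    open ≡-Reasoning
    f : ℕ → ℕ
    f i = ∣ suc (2 * i) - n ∣
    end : f n ≡ suc n
    end = begin
      ∣ suc (2 * n) - n ∣     ≡⟨ cong ∣_- n ∣ (split n) ⟩
      ∣ n + suc n - n ∣       ≡⟨ ∣m+n-m∣≡n n ⟩
      suc n                   ∎
      where
      split : ∀ n → suc (2 * n) ≡ n + suc n
      split = solve-∀
      ∣m+n-m∣≡n : ∀ m {n} → ∣ m + n - m ∣ ≡ n
      ∣m+n-m∣≡n m = trans (∣-∣-comm (m + _) m) (∣m-m+n∣≡n m _)
    regroup : ∀ n s → suc n + (s + suc n) ≡ s + 2 * suc n
    regroup = solve-∀

  sum-cartesianProduct : ∀ {A B : Set} (f : A → ℕ) (xs : List A) (ys : List B) →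
    sum (map (f ∘ proj₁) (cartesianProduct xs ys)) ≡ List.length ys * sum (map f xs)
  sum-cartesianProduct f []       ys = sym (*-zeroʳ (List.length ys))
  sum-cartesianProduct f (x ∷ xs) ys = begin
    sum (map (f ∘ proj₁) (map (x ,_) ys ++ cartesianProduct xs ys))
      ≡⟨ cong sum (List.map-++ (f ∘ proj₁) (map (x ,_) ys) _) ⟩
    sum (map (f ∘ proj₁) (map (x ,_) ys) ++ map (f ∘ proj₁) (cartesianProduct xs ys))
      ≡⟨ sum-++ (map (f ∘ proj₁) (map (x ,_) ys)) _ ⟩
    sum (map (f ∘ proj₁) (map (x ,_) ys)) + sum (map (f ∘ proj₁) (cartesianProduct xs ys))
      ≡⟨ cong₂ _+_ (row ys) (sum-cartesianProduct f xs ys) ⟩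
    List.length ys * f x + List.length ys * sum (map f xs)
      ≡⟨ *-distribˡ-+ (List.length ys) (f x) (sum (map f xs)) ⟨
    List.length ys * sum (map f (x ∷ xs)) ∎
    where
    open ≡-Reasoning
    row : ∀ ys → sum (map (f ∘ proj₁) (map (x ,_) ys)) ≡ List.length ys * f x
    row []       = refl
    row (y ∷ ys) = cong (f x +_) (row ys)

  spineSum-even : ∀ s → spineSum (s + s) ≡ 2 * (s * s)
  spineSum-even zero    = refl
  spineSum-even (suc s) rewrite +-suc s s = trans (spineSum-2+ (s + s))
    (trans (cong (_+ 2 * suc (s + s)) (spineSum-even s)) (next s))
    where
    next : ∀ s → 2 * (s * s) + 2 * suc (s + s) ≡ 2 * (suc s * suc s)
    next = solve-∀

  spineSum-odd : ∀ s → spineSum (suc (s + s)) ≡ 2 * (s * s + s)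
  spineSum-odd zero    = refl
  spineSum-odd (suc s) rewrite +-suc s s = trans (spineSum-2+ (suc (s + s)))
    (trans (cong (_+ 2 * suc (suc (s + s))) (spineSum-odd s)) (next s))
    where
    next : ∀ s → 2 * (s * s + s) + 2 * suc (suc (s + s)) ≡ 2 * (suc s * suc s + suc s)
    next = solve-∀

open FiniteSums

-- Weights measured from the middle of the spine

module CaterpillarColoring (t l : ℕ) where
  open import Data.Bool using (if_then_else_)
  open import Data.Fin as Fin using (toℕ)
  open import Data.Fin.Properties as Fin using (toℕ<n)
  open import Data.List as List using (List; []; _∷_; _++_; map; allFin; cartesianProduct)
  open import Data.List.Membership.Propositional using (_∈_)
  open import Data.List.Membership.Propositional.Properties
  open import Data.List.Properties as List using ()
  open import Data.List.Relation.Binary.Permutation.Propositional using (_↭_; ↭-sym; ↭⇒↭ₛ)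
  open import Data.List.Relation.Binary.Permutation.Propositional.Properties as Perm
    using (↭-length)
  import Data.List.Relation.Binary.Permutation.Setoid.Properties as PermS
  import Data.List.Sort
  open import Data.List.Relation.Unary.All as All using (All; []; _∷_)
  open import Data.List.Relation.Unary.AllPairs using ([]; _∷_)
  open import Data.List.Relation.Unary.Any using (here; there)
  open import Data.List.Relation.Unary.Linked using (Linked; []; _∷_)
  open import Data.List.Relation.Unary.Unique.Propositional using (Unique)
  import Data.List.Relation.Unary.Unique.Propositional.Properties as Unique
  open import Data.Nat using (ℕ; suc; _+_; _*_; _∸_; _≤_; _<_; s≤s; z≤n; ∣_-_∣)
  open import Data.Nat.ListAction using (sum)
  open import Data.Nat.ListAction.Properties using (sum-↭)
  open import Data.Nat.Properties
  open import Data.Nat.Tactic.RingSolver using (solve-∀)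
  open import Data.Product using (_×_; _,_)
  open import Data.Sum using (_⊎_; inj₁; inj₂)
  import Relation.Binary.Construct.On as On
  open import Relation.Binary.PropositionalEquality
    using (_≡_; _≢_; refl; sym; trans; cong; cong₂; subst; setoid; ≢-sym;
      module ≡-Reasoning)
  open import Relation.Nullary using (¬_; does; yes; no; contradiction)

  open CaterpillarDistance t l public

  G : ConnectedGraph
  G = C (suc (suc t)) (suc (suc l))

  N : ℕ
  N = suc t + t * l

  wt : V → ℕ
  wt v = 2 * ht v + ∣ suc (2 * pos v) - (2 + t) ∣

  -- Both compare `2 * pos v` with `1 + t`, twice the position of the middle. The inequalities are
  -- weak so that a vertex exactly at the middle counts on both sides.
  Low High : V → Set
  Low  v = suc (2 * pos v) ≤ 2 + t
  High v = 2 + t ≤ suc (2 * pos v)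

  2∣m-n∣≡∣1+2m-1+2n∣ : ∀ m n → 2 * ∣ m - n ∣ ≡ ∣ suc (2 * m) - suc (2 * n) ∣
  2∣m-n∣≡∣1+2m-1+2n∣ = *-distribˡ-∣-∣ 2

  -- The triangle inequality through the middle of the spine, doubled so that a middle between two
  -- vertices has an integer coordinate.
  2dist≤wt+wt : ∀ u v → 2 * dist u v ≤ wt u + wt v
  2dist≤wt+wt u v = begin
    2 * (ht v + (ht u + ∣ pos u - pos v ∣))
      ≡⟨ distrib (ht v) (ht u) ∣ pos u - pos v ∣ ⟩
    2 * ht u + 2 * ht v + 2 * ∣ pos u - pos v ∣
      ≡⟨ cong (2 * ht u + 2 * ht v +_) (2∣m-n∣≡∣1+2m-1+2n∣ (pos u) (pos v)) ⟩
    2 * ht u + 2 * ht v + ∣ a - b ∣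
      ≤⟨ +-monoʳ-≤ (2 * ht u + 2 * ht v) (∣-∣-triangle a (2 + t) b) ⟩
    2 * ht u + 2 * ht v + (∣ a - 2 + t ∣ + ∣ 2 + t - b ∣)
      ≡⟨ cong (λ d → 2 * ht u + 2 * ht v + (∣ a - 2 + t ∣ + d)) (∣-∣-comm (2 + t) b) ⟩
    2 * ht u + 2 * ht v + (∣ a - 2 + t ∣ + ∣ b - 2 + t ∣)
      ≡⟨ regroup (2 * ht u) (2 * ht v) ∣ a - 2 + t ∣ ∣ b - 2 + t ∣ ⟩
    wt u + wt v ∎
    where
    open ≤-Reasoning
    a b : ℕ
    a = suc (2 * pos u)
    b = suc (2 * pos v)
    distrib : ∀ x y d → 2 * (x + (y + d)) ≡ 2 * y + 2 * x + 2 * d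
    distrib = solve-∀
    regroup : ∀ x y d e → x + y + (d + e) ≡ x + d + (y + e)
    regroup = solve-∀

  -- With the middle between `u` and `v`, the triangle inequality in `2dist≤wt+wt` becomes an
  -- equality.
  Low-High⇒wt+wt≡2dist : ∀ u v → Low u → High v → wt u + wt v ≡ 2 * dist u v
  Low-High⇒wt+wt≡2dist u v a≤m m≤b = begin
    2 * ht u + ∣ a - 2 + t ∣ + (2 * ht v + ∣ b - 2 + t ∣)
      ≡⟨ cong₂ (λ d e → 2 * ht u + d + (2 * ht v + e)) (m≤n⇒∣m-n∣≡n∸m a≤m) (m≤n⇒∣n-m∣≡n∸m m≤b) ⟩
    2 * ht u + (2 + t ∸ a) + (2 * ht v + (b ∸ (2 + t)))
      ≡⟨ regroup (2 * ht u) (2 * ht v) (2 + t ∸ a) (b ∸ (2 + t)) ⟩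
    2 * ht u + 2 * ht v + ((b ∸ (2 + t)) + (2 + t ∸ a))
      ≡⟨ cong (2 * ht u + 2 * ht v +_) telescope ⟩
    2 * ht u + 2 * ht v + ∣ a - b ∣
      ≡⟨ cong (2 * ht u + 2 * ht v +_) (2∣m-n∣≡∣1+2m-1+2n∣ (pos u) (pos v)) ⟨
    2 * ht u + 2 * ht v + 2 * ∣ pos u - pos v ∣
      ≡⟨ distrib (ht v) (ht u) ∣ pos u - pos v ∣ ⟩
    2 * dist u v ∎
    where
    open ≡-Reasoning
    a b : ℕ
    a = suc (2 * pos u)
    b = suc (2 * pos v)
    telescope : (b ∸ (2 + t)) + (2 + t ∸ a) ≡ ∣ a - b ∣
    telescope = begin
      (b ∸ (2 + t)) + (2 + t ∸ a) ≡⟨ +-∸-assoc _ a≤m ⟨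
      (b ∸ (2 + t)) + (2 + t) ∸ a ≡⟨ cong (_∸ a) (m∸n+n≡m m≤b) ⟩
      b ∸ a                       ≡⟨ m≤n⇒∣m-n∣≡n∸m (≤-trans a≤m m≤b) ⟨
      ∣ a - b ∣                   ∎
    distrib : ∀ x y d → 2 * y + 2 * x + 2 * d ≡ 2 * (x + (y + d))
    distrib = solve-∀
    regroup : ∀ x y d e → x + d + (y + e) ≡ x + y + (e + d)
    regroup = solve-∀

  ∣2i-n∣≤n : ∀ {i n} → i ≤ n → ∣ 2 * i - n ∣ ≤ n
  ∣2i-n∣≤n {i} {n} i≤n with ≤-total (2 * i) n
  ... | inj₁ 2i≤n = ≤-trans (≤-reflexive (m≤n⇒∣m-n∣≡n∸m 2i≤n)) (m∸n≤m n (2 * i))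
  ... | inj₂ n≤2i = ≤-trans (≤-reflexive (m≤n⇒∣n-m∣≡n∸m n≤2i))
          (m≤n+o⇒m∸n≤o (2 * i) n (+-mono-≤ i≤n (≤-trans (≤-reflexive (+-identityʳ i)) i≤n)))

  -- A leg adds `2` to the weight but sits at an inner vertex, whose doubled distance from the
  -- middle is at most `t ∸ 1`.
  wt≤1+t : ∀ v → wt v ≤ suc t
  wt≤1+t (inj₁ i) = ∣2i-n∣≤n (m<1+n⇒m≤n (toℕ<n i))
  wt≤1+t (inj₂ (p , _)) rewrite ∣1+2[1+i]-2+n∣ (toℕ p) t = leg≤ (toℕ<n p)
    where
    leg≤ : ∀ {i n} → i < n → 2 + ∣ suc (2 * i) - n ∣ ≤ suc n
    leg≤ (s≤s i≤n) = s≤s (s≤s (∣2i-n∣≤n i≤n))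

  dist≤1+t : ∀ u v → dist u v ≤ suc t
  dist≤1+t u v = *-cancelˡ-≤ 2 (≤-trans (2dist≤wt+wt u v)
    (≤-trans (+-mono-≤ (wt≤1+t u) (wt≤1+t v)) (≤-reflexive (double (suc t)))))
    where
    double : ∀ n → n + n ≡ 2 * n
    double = solve-∀

  spineVertices legVertices : List V
  spineVertices = map inj₁ (allFin (2 + t))
  legVertices   = map inj₂ (cartesianProduct (allFin t) (allFin l))

  opaque
    allVertices : List V
    allVertices = spineVertices ++ legVertices

    ∈-allVertices : ∀ v → v ∈ allVertices
    ∈-allVertices (inj₁ i)       = ∈-++⁺ˡ (∈-map⁺ inj₁ (∈-allFin i))
    ∈-allVertices (inj₂ (p , q)) =
      ∈-++⁺ʳ spineVertices (∈-map⁺ inj₂ (∈-cartesianProduct⁺ (∈-allFin p) (∈-allFin q)))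

    allVertices-unique : Unique allVertices
    allVertices-unique = Unique.++⁺
      (Unique.map⁺ (λ { refl → refl }) (Unique.allFin⁺ (2 + t)))
      (Unique.map⁺ (λ { refl → refl }) (Unique.cartesianProduct⁺ (Unique.allFin⁺ t) (Unique.allFin⁺ l)))
      disjoint
      where
      disjoint : ∀ {v} → ¬ (v ∈ spineVertices × v ∈ legVertices)
      disjoint (v∈spine , v∈legs) with ∈-map⁻ inj₁ v∈spine | ∈-map⁻ inj₂ v∈legs
      ... | _ , _ , refl | _ , _ , ()

    length-allVertices : List.length allVertices ≡ suc N
    length-allVertices = trans (List.length-++ spineVertices) (cong₂ _+_
      (trans (List.length-map inj₁ (allFin (2 + t))) (length-allFin (2 + t)))
      (trans (List.length-map inj₂ (cartesianProduct (allFin t) (allFin l)))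
        (trans (length-cartesianProduct (allFin t) (allFin l))
          (cong₂ _*_ (length-allFin t) (length-allFin l)))))

  Σwt : List V → ℕ
  Σwt xs = sum (map wt xs)

  Σwt-↭ : ∀ {xs ys} → xs ↭ ys → Σwt xs ≡ Σwt ys
  Σwt-↭ xs↭ys = sum-↭ (Perm.map⁺ wt xs↭ys)

  lastOf : V → List V → V
  lastOf x []       = x
  lastOf _ (y ∷ ys) = lastOf y ys

  lastOf-∈ : ∀ x xs → lastOf x xs ∈ x ∷ xs
  lastOf-∈ x []       = here refl
  lastOf-∈ x (y ∷ ys) = there (lastOf-∈ y ys)

  -- Lower bound: the vertices in order of increasing color

  module LowerBound {c} (hc : IsHamiltonianColoring G c) where

    -- The coloring condition bounds the color difference from below by `N` minus the distance, and
    -- `2dist≤wt+wt` replaces the distance by weights. Terms are moved across so that nothing is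
    -- subtracted.
    coloring-step : ∀ {x y} → x ≢ y → c x ≤ c y → 2 * (N + c x) ≤ wt x + wt y + 2 * c y
    coloring-step {x} {y} x≢y cx≤cy with D , D-max , N≤D+gap ← hc x y x≢y
      rewrite detourDistance⇒dist x≢y D-max | m≤n⇒∣m-n∣≡n∸m cx≤cy = begin
      2 * (N + c x)                         ≤⟨ *-monoʳ-≤ 2 (+-monoˡ-≤ (c x) N≤D+gap) ⟩
      2 * (dist x y + (c y ∸ c x) + c x)    ≡⟨ cong (2 *_) (+-assoc (dist x y) (c y ∸ c x) (c x)) ⟩
      2 * (dist x y + (c y ∸ c x + c x))    ≡⟨ cong (λ d → 2 * (dist x y + d)) (m∸n+n≡m cx≤cy) ⟩
      2 * (dist x y + c y)                  ≡⟨ *-distribˡ-+ 2 (dist x y) (c y) ⟩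
      2 * dist x y + 2 * c y                ≤⟨ +-monoˡ-≤ (2 * c y) (2dist≤wt+wt x y) ⟩
      wt x + wt y + 2 * c y                 ∎
      where open ≤-Reasoning

    -- Adding `coloring-step` over consecutive pairs counts the weight of each inner entry twice but
    -- those of the two ends once. The end weights on the left compensate for `2 * Σwt` on the
    -- right.
    telescope : ∀ x xs → Linked (λ u v → c u ≤ c v) (x ∷ xs) → Unique (x ∷ xs) →
      2 * (N * List.length xs) + (2 * c x + (wt x + wt (lastOf x xs)))
        ≤ 2 * Σwt (x ∷ xs) + 2 * c (lastOf x xs)
    telescope x [] _ _ = ≤-reflexive (base N (c x) (wt x))
      where
      base : ∀ n a w → 2 * (n * 0) + (2 * a + (w + w)) ≡ 2 * (w + 0) + 2 * a
      base = solve-∀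
    telescope x (y ∷ ys) (cx≤cy ∷ sorted) ((x≢y ∷ _) ∷ unique) =
      -- With `wt y + 2 * c y` added to both sides, the claim is the sum of the induction hypothesis
      -- and `coloring-step`, up to a common `wt x`.
      +-cancelʳ-≤ (wt y + 2 * c y) _ _ (begin
        2 * (N * suc L) + (2 * c x + (wt x + e)) + (wt y + 2 * c y)
          ≡⟨ lhs N L (c x) (wt x) e (wt y) (c y) ⟩
        (2 * (N * L) + (2 * c y + (wt y + e))) + 2 * (N + c x) + wt x
          ≤⟨ +-monoˡ-≤ (wt x) (+-mono-≤ (telescope y ys sorted unique) (coloring-step x≢y cx≤cy)) ⟩
        (2 * S + 2 * a) + (wt x + wt y + 2 * c y) + wt x
          ≡⟨ rhs S a (wt x) (wt y) (c y) ⟩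
        2 * (wt x + S) + 2 * a + (wt y + 2 * c y) ∎)
      where
      open ≤-Reasoning
      L e S a : ℕ
      L = List.length ys
      e = wt (lastOf y ys)
      S = Σwt (y ∷ ys)
      a = c (lastOf y ys)
      lhs : ∀ n L cx wx e wy cy → 2 * (n * suc L) + (2 * cx + (wx + e)) + (wy + 2 * cy)
          ≡ (2 * (n * L) + (2 * cy + (wy + e))) + 2 * (n + cx) + wx
      lhs = solve-∀
      rhs : ∀ S a wx wy cy → (2 * S + 2 * a) + (wx + wy + 2 * cy) + wx
          ≡ 2 * (wx + S) + 2 * a + (wy + 2 * cy)
      rhs = solve-∀

    -- The ends of the list are distinct, so their weights sum to at least `2`; after halving, this
    -- is the `1` in the bound. The color of the first entry is dropped as nonnegative.
    ordering-bound : ∀ xs → Linked (λ u v → c u ≤ c v) xs → Unique xs →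
      List.length xs ≡ suc N → N * N + 1 ≤ Σwt xs + maxColor G c
    ordering-bound (x ∷ y ∷ ys) sorted unique@(x∉ ∷ _) len = *-cancelˡ-≤ 2 (begin
      2 * (N * N + 1)
        ≡⟨ *-distribˡ-+ 2 (N * N) 1 ⟩
      2 * (N * N) + 2
        ≤⟨ +-monoʳ-≤ (2 * (N * N)) (begin
             2                ≤⟨ *-monoʳ-≤ 2 (1≤dist (All.lookup x∉ (lastOf-∈ y ys))) ⟩
             2 * dist x z     ≤⟨ 2dist≤wt+wt x z ⟩
             wt x + wt z      ≤⟨ m≤n+m _ (2 * c x) ⟩
             2 * c x + (wt x + wt z) ∎) ⟩
      2 * (N * N) + (2 * c x + (wt x + wt z))
        ≡⟨ cong (λ n → 2 * (N * n) + (2 * c x + (wt x + wt z))) (suc-injective len) ⟨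
      2 * (N * suc (List.length ys)) + (2 * c x + (wt x + wt z))
        ≤⟨ telescope x (y ∷ ys) sorted unique ⟩
      2 * S + 2 * c z
        ≡⟨ *-distribˡ-+ 2 S (c z) ⟨
      2 * (S + c z)
        ≤⟨ *-monoʳ-≤ 2 (+-monoʳ-≤ S (color≤maxColor G c z)) ⟩
      2 * (S + maxColor G c) ∎)
      where
      open ≤-Reasoning
      z : V
      z = lastOf y ys
      S : ℕ
      S = Σwt (x ∷ y ∷ ys)

    -- Sorting the vertices by color makes `ordering-bound` applicable; length, uniqueness and total
    -- weight survive the permutation.
    lower-bound : N * N + 1 ≤ Σwt allVertices + maxColor G c
    lower-bound = subst (λ S → N * N + 1 ≤ S + maxColor G c) (Σwt-↭ sorted↭)
      (ordering-bound (sort allVertices) (sort-↗ allVertices)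
        (PermS.Unique-resp-↭ (setoid V) (↭⇒↭ₛ (↭-sym sorted↭)) allVertices-unique)
        (trans (↭-length sorted↭) length-allVertices))
      where
      open Data.List.Sort (On.decTotalOrder ≤-decTotalOrder c) using (sort; sort-↭; sort-↗)
      sorted↭ = sort-↭ allVertices

  -- Colorings built from orderings of the vertices

  gap : V → V → ℕ
  gap x y = N ∸ dist x y

  -- The color of `v` sums the gaps before its first occurrence. A vertex missing from the list
  -- would get the full `total`; `colors-hamiltonian` asks for lists that contain every vertex.
  colors : List V → V → ℕ
  colors []           v = 0
  colors (x ∷ [])     v = 0
  colors (x ∷ y ∷ ys) v = if does (v ≟V x) then 0 else gap x y + colors (y ∷ ys) v

  total : List V → ℕ
  total []           = 0
  total (x ∷ [])     = 0
  total (x ∷ y ∷ ys) = gap x y + total (y ∷ ys)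

  colors≤total : ∀ xs v → colors xs v ≤ total xs
  colors≤total []           v = z≤n
  colors≤total (x ∷ [])     v = z≤n
  colors≤total (x ∷ y ∷ ys) v with v ≟V x | colors≤total (y ∷ ys) v
  ... | yes _ | _  = z≤n
  ... | no  _ | c≤ = +-monoʳ-≤ (gap x y) c≤

  -- This is what remains of `N = suc t + t * l` after removing the bound `suc t` on distances.
  tl≤gap : ∀ x y → t * l ≤ gap x y
  tl≤gap x y = m+n≤o⇒n≤o∸m (dist x y) (+-monoˡ-≤ (t * l) (dist≤1+t x y))
    where
    m+n≤o⇒n≤o∸m : ∀ m {n o} → m + n ≤ o → n ≤ o ∸ m
    m+n≤o⇒n≤o∸m m {n} m+n≤o = m+n≤o⇒m≤o∸n n (≤-trans (≤-reflexive (+-comm n m)) m+n≤o)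

  colors-∷ : ∀ {v} x y ys → v ≢ x → colors (x ∷ y ∷ ys) v ≡ gap x y + colors (y ∷ ys) v
  colors-∷ {v} x y ys v≢x with v ≟V x
  ... | yes v≡x = contradiction v≡x v≢x
  ... | no  _   = refl

  colors-head : ∀ x xs → colors (x ∷ xs) x ≡ 0
  colors-head x []       = refl
  colors-head x (y ∷ ys) with x ≟V x
  ... | yes _   = refl
  ... | no  x≢x = contradiction refl x≢x

  module _ (1≤l : 1 ≤ l) where

    -- Here `3 ≤ k` enters: with at least one leg at each inner vertex, `t ≤ t * l`.
    N≤1+2gaps : N ≤ 1 + (t * l + t * l)
    N≤1+2gaps = s≤s (+-monoˡ-≤ (t * l)
      (≤-trans (≤-reflexive (sym (*-identityʳ t))) (*-monoʳ-≤ t 1≤l)))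

    -- Two gaps already make up for any distance, so only the colors of
    -- consecutive vertices need care.
    colors-from-head : ∀ {v} x y ys → v ≢ x → v ∈ y ∷ ys → N ≤ dist x v + colors (x ∷ y ∷ ys) v
    colors-from-head {v} x y ys v≢x v∈ rewrite colors-∷ x y ys v≢x with v ≟V y
    ... | yes refl = ≤-trans (m≤n+m∸n N (dist x v)) (+-monoʳ-≤ (dist x v) (m≤m+n (gap x v) _))
    colors-from-head x y []       v≢x (here v≡y) | no v≢y = contradiction v≡y v≢y
    colors-from-head {v} x y (z ∷ zs) v≢x _ | no v≢y rewrite colors-∷ y z zs v≢y =
      ≤-trans N≤1+2gaps (+-mono-≤ (1≤dist (≢-sym v≢x))
        (+-mono-≤ (tl≤gap x y) (≤-trans (tl≤gap y z) (m≤m+n (gap y z) _))))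

    -- A head different from both vertices adds the same gap to both colors, and it cancels in the
    -- difference. Once one of the two is the head, its color is `0` and `colors-from-head` applies.
    colors-separate : ∀ xs {u v} → u ≢ v → u ∈ xs → v ∈ xs →
      N ≤ dist u v + ∣ colors xs u - colors xs v ∣
    colors-separate (x ∷ []) u≢v (here refl) (here refl) = contradiction refl u≢v
    colors-separate (x ∷ y ∷ ys) {u} {v} u≢v u∈ v∈ with u ≟V x | v ≟V x
    ... | yes refl | yes refl = contradiction refl u≢v
    colors-separate (x ∷ y ∷ ys) {v = v} u≢v u∈ (here v≡x) | yes _ | no v≢x = contradiction v≡x v≢x
    colors-separate (x ∷ y ∷ ys) {v = v} u≢v u∈ (there v∈) | yes refl | no v≢x =
      subst (λ d → N ≤ dist x v + d) (colors-∷ x y ys v≢x) (colors-from-head x y ys v≢x v∈)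
    colors-separate (x ∷ y ∷ ys) {u} u≢v (here u≡x) v∈ | no u≢x | yes _ = contradiction u≡x u≢x
    colors-separate (x ∷ y ∷ ys) {u} u≢v (there u∈) v∈ | no u≢x | yes refl =
      subst (N ≤_) (cong₂ _+_ (dist-comm x u) (trans (colors-∷ x y ys u≢x) (sym (∣-∣-identityʳ _))))
        (colors-from-head x y ys u≢x u∈)
    colors-separate (x ∷ y ∷ ys) u≢v (here u≡x) v∈ | no u≢x | no v≢x = contradiction u≡x u≢x
    colors-separate (x ∷ y ∷ ys) u≢v (there u∈) (here v≡x) | no u≢x | no v≢x = contradiction v≡x v≢x
    colors-separate (x ∷ y ∷ ys) {u} {v} u≢v (there u∈) (there v∈) | no _ | no _
      rewrite ∣m+n-m+o∣≡∣n-o∣ (gap x y) (colors (y ∷ ys) u) (colors (y ∷ ys) v) =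
      colors-separate (y ∷ ys) u≢v u∈ v∈

    colors-hamiltonian : ∀ xs → (∀ v → v ∈ xs) → IsHamiltonianColoring G (colors xs)
    colors-hamiltonian xs v∈xs u v u≢v =
      dist u v , isDetourDistance-dist u≢v , colors-separate xs u≢v (v∈xs u) (v∈xs v)

  Opposite : V → V → Set
  Opposite u v = (Low u × High v) ⊎ (High u × Low v)

  opposite⇒wt+wt≤2dist : ∀ u v → Opposite u v → wt u + wt v ≤ 2 * dist u v
  opposite⇒wt+wt≤2dist u v (inj₁ (lo , hi)) = ≤-reflexive (Low-High⇒wt+wt≡2dist u v lo hi)
  opposite⇒wt+wt≤2dist u v (inj₂ (hi , lo)) = ≤-reflexive
    (trans (+-comm (wt u) (wt v))
      (trans (Low-High⇒wt+wt≡2dist v u lo hi) (cong (2 *_) (dist-comm v u))))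

  gap-opposite : ∀ u v → Opposite u v → 2 * gap u v + (wt u + wt v) ≤ 2 * N
  gap-opposite u v opp = begin
    2 * gap u v + (wt u + wt v)       ≤⟨ +-monoʳ-≤ (2 * gap u v) (opposite⇒wt+wt≤2dist u v opp) ⟩
    2 * gap u v + 2 * dist u v        ≡⟨ *-distribˡ-+ 2 (gap u v) (dist u v) ⟨
    -- The subtraction in `gap` is not truncated: distances are at most `suc t`, hence at most `N`.
    2 * (gap u v + dist u v)          ≡⟨ cong (2 *_) (m∸n+n≡m (≤-trans (dist≤1+t u v) (m≤m+n (suc t) (t * l)))) ⟩
    2 * N                             ∎
    where open ≤-Reasoning

  -- The counterpart of `telescope`: for opposite neighbours the weights bound the gap from above,
  -- so the same summation yields the reverse inequality.
  total-telescope : ∀ x xs → Linked Opposite (x ∷ xs) →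
    2 * total (x ∷ xs) + 2 * Σwt (x ∷ xs) ≤ 2 * (N * List.length xs) + (wt x + wt (lastOf x xs))
  total-telescope x [] _ = ≤-reflexive (base N (wt x))
    where
    base : ∀ n w → 2 * (w + 0) ≡ 2 * (n * 0) + (w + w)
    base = solve-∀
  total-telescope x (y ∷ ys) (opp ∷ linked) = +-cancelʳ-≤ (wt y) _ _ (begin
    2 * (g + T) + 2 * (wt x + S) + wt y
      ≡⟨ lhs g T (wt x) S (wt y) ⟩
    (2 * T + 2 * S) + (2 * g + (wt x + wt y)) + wt x
      ≤⟨ +-monoˡ-≤ (wt x) (+-mono-≤ (total-telescope y ys linked) (gap-opposite x y opp)) ⟩
    (2 * (N * L) + (wt y + e)) + 2 * N + wt x
      ≡⟨ rhs N L (wt y) e (wt x) ⟩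
    2 * (N * suc L) + (wt x + e) + wt y ∎)
    where
    open ≤-Reasoning
    g T L e S : ℕ
    g = gap x y
    T = total (y ∷ ys)
    L = List.length ys
    e = wt (lastOf y ys)
    S = Σwt (y ∷ ys)
    lhs : ∀ g T wx S wy → 2 * (g + T) + 2 * (wx + S) + wy
        ≡ (2 * T + 2 * S) + (2 * g + (wx + wy)) + wx
    lhs = solve-∀
    rhs : ∀ n L wy e wx → (2 * (n * L) + (wy + e)) + 2 * n + wx
        ≡ 2 * (n * suc L) + (wx + e) + wy
    rhs = solve-∀

-- Reflection of the spine and alternating orderings

module CaterpillarOrdering (t l : ℕ) where
  open import Data.Fin as Fin using (Fin; toℕ; fromℕ<; opposite)
  open import Data.Fin.Properties as Fin
    using (toℕ<n; toℕ-fromℕ<; opposite-prop; opposite-involutive)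
  open import Data.List as List
    using (List; []; _∷_; _++_; map; allFin; cartesianProduct; applyUpTo; filter)
  open import Data.List.Membership.Propositional using (_∈_; _∉_)
  open import Data.List.Membership.Propositional.Properties
  open import Data.List.Membership.Propositional.Properties.WithK using (unique∧set⇒bag)
  open import Data.List.Properties as List using (map-∘)
  open import Data.List.Relation.Binary.BagAndSetEquality using (∼bag⇒↭)
  open import Data.List.Relation.Binary.Permutation.Propositional using (_↭_)
  open import Data.List.Relation.Binary.Permutation.Propositional.Properties using (↭-length)
  open import Data.List.Relation.Unary.All as All using (All; []; _∷_)
  import Data.List.Relation.Unary.All.Properties as All
  open import Data.List.Relation.Unary.AllPairs using ([]; _∷_)
  open import Data.List.Relation.Unary.Any using (here; there)
  open import Data.List.Relation.Unary.Linked using (Linked; []; [-]; _∷_)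
  open import Data.List.Relation.Unary.Unique.Propositional using (Unique)
  import Data.List.Relation.Unary.Unique.Propositional.Properties as Unique
  open import Data.Nat using (ℕ; zero; suc; _+_; _*_; _≤_; _<_; s≤s; ∣_-_∣)
  open import Data.Nat.ListAction using (sum)
  open import Data.Nat.ListAction.Properties using (sum-++)
  open import Data.Nat.Properties
  open import Data.Nat.Tactic.RingSolver using (solve-∀)
  open import Data.Product using (_×_; _,_; ∃-syntax; proj₁; proj₂)
  open import Data.Sum using (_⊎_; inj₁; inj₂; [_,_]′)
  open import Function using (_∘_; mk⇔)
  open import Relation.Binary.Definitions using (tri<; tri≈; tri>)
  open import Relation.Binary.PropositionalEquality
    using (_≡_; _≢_; refl; sym; trans; cong; cong₂; subst; module ≡-Reasoning)
  open import Relation.Nullary using (Dec; yes; no)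
  open import Relation.Nullary.Decidable using (_×-dec_; ¬?)

  open CaterpillarColoring t l public

  mirror : V → V
  mirror (inj₁ i)       = inj₁ (opposite i)
  mirror (inj₂ (p , q)) = inj₂ (opposite p , q)

  mirror-involutive : ∀ v → mirror (mirror v) ≡ v
  mirror-involutive (inj₁ i)       = cong inj₁ (opposite-involutive i)
  mirror-involutive (inj₂ (p , q)) = cong (λ p → inj₂ (p , q)) (opposite-involutive p)

  pos-mirror : ∀ v → pos (mirror v) + pos v ≡ suc t
  pos-mirror (inj₁ i)       = trans (cong (_+ toℕ i) (opposite-prop i)) (m∸n+n≡m (m<1+n⇒m≤n (toℕ<n i)))
  pos-mirror (inj₂ (p , _)) = cong suc
    (trans (cong (_+ suc (toℕ p)) (opposite-prop p)) (m∸n+n≡m (toℕ<n p)))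

  Lower Higher Middle : V → Set
  Lower  v = suc (2 * pos v) < 2 + t
  Higher v = 2 + t < suc (2 * pos v)
  Middle v = Low v × High v

  -- Reflection negates the offset of `suc (2 * pos v)` from `2 + t`. The four lemmas that follow
  -- read off how the sides are exchanged.
  side-mirror : ∀ v → suc (2 * pos (mirror v)) + suc (2 * pos v) ≡ (2 + t) + (2 + t)
  side-mirror v = begin
    suc (2 * pos (mirror v)) + suc (2 * pos v) ≡⟨ collect (pos (mirror v)) (pos v) ⟩
    2 + 2 * (pos (mirror v) + pos v)           ≡⟨ cong (λ n → 2 + 2 * n) (pos-mirror v) ⟩
    2 + 2 * suc t                              ≡⟨ expand t ⟩
    (2 + t) + (2 + t)                          ∎
    where
    open ≡-Reasoning
    collect : ∀ a b → suc (2 * a) + suc (2 * b) ≡ 2 + 2 * (a + b)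
    collect = solve-∀
    expand : ∀ n → 2 + 2 * suc n ≡ (2 + n) + (2 + n)
    expand = solve-∀

  mirror-Lower : ∀ v → Lower v → Higher (mirror v)
  mirror-Lower v lower = ≰⇒> λ low → <-irrefl (side-mirror v) (+-mono-≤-< low lower)

  mirror-Higher : ∀ v → Higher v → Lower (mirror v)
  mirror-Higher v higher = ≰⇒> λ high → <-irrefl (sym (side-mirror v)) (+-mono-≤-< high higher)

  mirror-Low : ∀ v → Low v → High (mirror v)
  mirror-Low v low = ≮⇒≥ λ lower → <-irrefl (side-mirror v) (+-mono-<-≤ lower low)

  mirror-High : ∀ v → High v → Low (mirror v)
  mirror-High v high = ≮⇒≥ λ higher → <-irrefl (sym (side-mirror v)) (+-mono-<-≤ higher high)

  -- For `as` on the lower side each pair runs high, then low. After a low vertex the list therefore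
  -- alternates, and it is back on the low side when `rest` begins.
  zigzag : List V → List V → List V
  zigzag []       rest = rest
  zigzag (a ∷ as) rest = mirror a ∷ a ∷ zigzag as rest

  ∈-zigzag⁺ : ∀ {v} as {rest} → v ∈ as ⊎ mirror v ∈ as ⊎ v ∈ rest → v ∈ zigzag as rest
  ∈-zigzag⁺ []       (inj₂ (inj₂ v∈rest))       = v∈rest
  ∈-zigzag⁺ (a ∷ as) (inj₁ (here v≡a))          = there (here v≡a)
  ∈-zigzag⁺ (a ∷ as) (inj₁ (there v∈as))        = there (there (∈-zigzag⁺ as (inj₁ v∈as)))
  ∈-zigzag⁺ (a ∷ as) (inj₂ (inj₁ (here refl)))  = here (sym (mirror-involutive _))
  ∈-zigzag⁺ (a ∷ as) (inj₂ (inj₁ (there v′∈as))) = there (there (∈-zigzag⁺ as (inj₂ (inj₁ v′∈as))))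
  ∈-zigzag⁺ (a ∷ as) (inj₂ (inj₂ v∈rest))       = there (there (∈-zigzag⁺ as (inj₂ (inj₂ v∈rest))))

  ∈-zigzag⁻ : ∀ {v} as {rest} → v ∈ zigzag as rest → v ∈ as ⊎ mirror v ∈ as ⊎ v ∈ rest
  ∈-zigzag⁻ []       v∈rest              = inj₂ (inj₂ v∈rest)
  ∈-zigzag⁻ (a ∷ as) (here refl)         = inj₂ (inj₁ (here (mirror-involutive a)))
  ∈-zigzag⁻ (a ∷ as) (there (here v≡a))  = inj₁ (here v≡a)
  ∈-zigzag⁻ (a ∷ as) (there (there v∈)) with ∈-zigzag⁻ as v∈
  ... | inj₁ v∈as           = inj₁ (there v∈as)
  ... | inj₂ (inj₁ v′∈as)   = inj₂ (inj₁ (there v′∈as))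
  ... | inj₂ (inj₂ v∈rest)  = inj₂ (inj₂ v∈rest)

  -- All of `as` lies strictly below the middle, so the mirror images lie strictly above it and the
  -- two families cannot meet. Within the second family, `mirror` is injective as an involution.
  zigzag-unique : ∀ as {rest} → All Lower as → Unique as → Unique rest →
    (∀ {v} → v ∈ as → v ∉ rest × mirror v ∉ rest) → Unique (zigzag as rest)
  zigzag-unique [] _ _ rest! _ = rest!
  zigzag-unique (a ∷ as) {rest} (lower ∷ lowers) (a∉ ∷ as!) rest! apart =
    All.¬Any⇒All¬ _ mirror-fresh ∷ All.¬Any⇒All¬ _ fresh ∷
    zigzag-unique as lowers as! rest! (apart ∘ there)
    where
    a∉as : a ∉ as
    a∉as a∈as = All.lookup a∉ a∈as refl
    mirror∉ : mirror a ∉ as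
    mirror∉ a′∈as = <-asym (mirror-Lower a lower) (All.lookup lowers a′∈as)
    fresh : a ∉ zigzag as rest
    fresh a∈ with ∈-zigzag⁻ as a∈
    ... | inj₁ a∈as          = a∉as a∈as
    ... | inj₂ (inj₁ a′∈as)  = mirror∉ a′∈as
    ... | inj₂ (inj₂ a∈rest) = proj₁ (apart (here refl)) a∈rest
    mirror-fresh : mirror a ∉ a ∷ zigzag as rest
    mirror-fresh (here a′≡a) = <-asym (mirror-Lower a lower) (subst Lower (sym a′≡a) lower)
    mirror-fresh (there a′∈) with ∈-zigzag⁻ as a′∈
    ... | inj₁ a′∈as          = mirror∉ a′∈as
    ... | inj₂ (inj₁ a″∈as)   = a∉as (subst (_∈ as) (mirror-involutive a) a″∈as)
    ... | inj₂ (inj₂ a′∈rest) = proj₂ (apart (here refl)) a′∈rest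

  -- The hypothesis on `rest` covers every low `y` because the entry before `rest` is either `x` or
  -- the last entry of `as`.
  zigzag-linked : ∀ {x} as {rest} → Low x → All Lower as →
    (∀ {y} → Low y → Linked Opposite (y ∷ rest)) → Linked Opposite (x ∷ zigzag as rest)
  zigzag-linked [] low _ link = link low
  zigzag-linked (a ∷ as) low (lower ∷ lowers) link =
    inj₁ (low , <⇒≤ (mirror-Lower a lower)) ∷ inj₂ (<⇒≤ (mirror-Lower a lower) , <⇒≤ lower) ∷
    zigzag-linked as (<⇒≤ lower) lowers link

  -- A middle vertex lies on both sides at once, so middle vertices may follow one another in any
  -- order.
  middle-linked : ∀ {x y} zs → Low x → All Middle zs → High y → Linked Opposite (x ∷ zs ++ y ∷ [])
  middle-linked []       low _                      high = inj₁ (low , high) ∷ [-]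
  middle-linked (z ∷ zs) low ((lowz , highz) ∷ mid) high =
    inj₁ (low , highz) ∷ middle-linked zs lowz mid high

  lastOf-++ : ∀ x zs y → lastOf x (zs ++ y ∷ []) ≡ y
  lastOf-++ x []       y = refl
  lastOf-++ x (z ∷ zs) y = lastOf-++ z zs y

  lastOf-zigzag : ∀ x as zs y → lastOf x (zigzag as (zs ++ y ∷ [])) ≡ y
  lastOf-zigzag x []       zs y = lastOf-++ x zs y
  lastOf-zigzag x (a ∷ as) zs y = lastOf-zigzag a as zs y

  HasChromaticNumber : Set
  HasChromaticNumber = ∃[ h ] IsHamiltonianChromaticNumber G h × Σwt allVertices + h ≡ N * N + 1

  -- An ordering that attains the lower bound

  module OptimalOrdering
    (first final : V) (low : Low first) (high : High final) (adjacent : dist first final ≡ 1)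
    (first≢final : first ≢ final)
    -- For even `m` the ends are mirror images across the central edge; for odd `m` both lie at the
    -- middle. Either alternative ensures that the pairs built from `sides` do not repeat `final`
    -- and that leaving out `first` loses no other vertex.
    (symmetric : final ≡ mirror first ⊎ (High first × Low final)) where

    side? : (v : V) → Dec (Lower v × v ≢ first)
    side? v = (suc (2 * pos v) <? 2 + t) ×-dec ¬? (v ≟V first)

    middle? : (v : V) → Dec (Middle v × v ≢ first × v ≢ final)
    middle? v = ((suc (2 * pos v) ≤? 2 + t) ×-dec (2 + t ≤? suc (2 * pos v)))
      ×-dec (¬? (v ≟V first) ×-dec ¬? (v ≟V final))

    sides middles : List V
    sides   = filter side? allVertices
    middles = filter middle? allVertices

    ∈-sides⁻ : ∀ {v} → v ∈ sides → Lower v × v ≢ first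
    ∈-sides⁻ v∈ = proj₂ (∈-filter⁻ side? {xs = allVertices} v∈)

    ∈-sides⁺ : ∀ {v} → Lower v → v ≢ first → v ∈ sides
    ∈-sides⁺ lower v≢ = ∈-filter⁺ side? (∈-allVertices _) (lower , v≢)

    ∈-middles⁻ : ∀ {v} → v ∈ middles → Middle v × v ≢ first × v ≢ final
    ∈-middles⁻ v∈ = proj₂ (∈-filter⁻ middle? {xs = allVertices} v∈)

    tail ordering : List V
    tail     = zigzag sides (middles ++ final ∷ [])
    ordering = first ∷ tail

    sides-lower : All Lower sides
    sides-lower = All.tabulate (proj₁ ∘ ∈-sides⁻)

    ordering-linked : Linked Opposite ordering
    ordering-linked = zigzag-linked sides low sides-lower λ lowy →
      middle-linked middles lowy (All.tabulate (proj₁ ∘ ∈-middles⁻)) high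

    -- Otherwise `final` would occur both in a pair and at the end. Its mirror image is either
    -- `first`, which is excluded, or not strictly below the middle.
    mirror-final∉sides : mirror final ∉ sides
    mirror-final∉sides f′∈ with lower , f′≢ ← ∈-sides⁻ f′∈ =
      [ (λ final≡ → f′≢ (trans (cong mirror final≡) (mirror-involutive first)))
      , (λ (_ , lowf) → <⇒≱ lower (mirror-Low final lowf)) ]′ symmetric

    tail-unique : Unique tail
    tail-unique = zigzag-unique sides sides-lower (Unique.filter⁺ side? allVertices-unique)
      (Unique.++⁺ (Unique.filter⁺ middle? allVertices-unique) ([] ∷ [])
        λ { (v∈ , here refl) → proj₂ (proj₂ (∈-middles⁻ v∈)) refl })
      λ v∈ → apart v∈ , mirror-apart v∈
      where
      apart : ∀ {v} → v ∈ sides → v ∉ middles ++ final ∷ []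
      apart v∈ v∈rest with lower , _ ← ∈-sides⁻ v∈ with ∈-++⁻ middles v∈rest
      ... | inj₁ v∈mid       = <⇒≱ lower (proj₂ (proj₁ (∈-middles⁻ v∈mid)))
      ... | inj₂ (here refl) = <⇒≱ lower high
      mirror-apart : ∀ {v} → v ∈ sides → mirror v ∉ middles ++ final ∷ []
      mirror-apart {v} v∈ v′∈rest with ∈-++⁻ middles v′∈rest
      ... | inj₁ v′∈mid      = <⇒≱ (mirror-Lower v (proj₁ (∈-sides⁻ v∈))) (proj₁ (proj₁ (∈-middles⁻ v′∈mid)))
      ... | inj₂ (here refl) = mirror-final∉sides (subst (_∈ sides) (sym (mirror-involutive v)) v∈)

    first∉tail : first ∉ tail
    first∉tail f∈ with ∈-zigzag⁻ sides f∈
    ... | inj₁ f∈sides         = proj₂ (∈-sides⁻ f∈sides) refl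
    ... | inj₂ (inj₁ f′∈sides) = <⇒≱ (proj₁ (∈-sides⁻ f′∈sides)) (mirror-Low first low)
    ... | inj₂ (inj₂ f∈rest) with ∈-++⁻ middles f∈rest
    ...   | inj₁ f∈mid      = proj₁ (proj₂ (∈-middles⁻ f∈mid)) refl
    ...   | inj₂ (here eq)  = first≢final eq

    ordering-unique : Unique ordering
    ordering-unique = All.¬Any⇒All¬ _ first∉tail ∷ tail-unique

    -- A higher vertex enters the ordering through its mirror image in `sides`, where `first` is
    -- missing; only `final` could be lost this way.
    mirror≢first : ∀ {v} → Higher v → v ≢ final → mirror v ≢ first
    mirror≢first {v} higher v≢final v′≡first =
      [ (λ final≡ → v≢final (trans (sym (mirror-involutive v))
                              (trans (cong mirror v′≡first) (sym final≡))))
      , (λ (highf , _) → <⇒≱ (mirror-Higher v higher) (subst High (sym v′≡first) highf)) ]′ symmetric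

    ∈-ordering : ∀ v → v ∈ ordering
    ∈-ordering v with v ≟V first | v ≟V final
    ... | yes v≡first | _ = here v≡first
    ... | no _ | yes v≡final = there (∈-zigzag⁺ sides (inj₂ (inj₂ (∈-++⁺ʳ middles (here v≡final)))))
    ... | no v≢first | no v≢final with <-cmp (suc (2 * pos v)) (2 + t)
    ...   | tri< lower _ _ = there (∈-zigzag⁺ sides (inj₁ (∈-sides⁺ lower v≢first)))
    ...   | tri> _ _ higher = there (∈-zigzag⁺ sides (inj₂ (inj₁
              (∈-sides⁺ (mirror-Higher v higher) (mirror≢first higher v≢final)))))
    ...   | tri≈ _ eq _ = there (∈-zigzag⁺ sides (inj₂ (inj₂ (∈-++⁺ˡ
              (∈-filter⁺ middle? (∈-allVertices v)
                ((≤-reflexive eq , ≤-reflexive (sym eq)) , v≢first , v≢final))))))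

    -- Duplicate-free lists with the same elements are permutations of each other. This carries
    -- length and total weight over to the ordering.
    ordering-↭ : ordering ↭ allVertices
    ordering-↭ = ∼bag⇒↭ (unique∧set⇒bag ordering-unique allVertices-unique
      (λ {v} → mk⇔ (λ _ → ∈-allVertices v) (λ _ → ∈-ordering v)))

    length-tail : List.length tail ≡ N
    length-tail = suc-injective (trans (↭-length ordering-↭) length-allVertices)

    -- The ends are adjacent and opposite, so their weights have the least sum that the lower bound
    -- allows.
    ends : wt first + wt (lastOf first tail) ≡ 2
    ends rewrite lastOf-zigzag first sides middles final =
      trans (Low-High⇒wt+wt≡2dist first final low high) (cong (2 *_) adjacent)

    total-bound : Σwt allVertices + total ordering ≤ N * N + 1
    total-bound = *-cancelˡ-≤ 2 (begin
      2 * (Σwt allVertices + total ordering)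
        ≡⟨ cong (λ S → 2 * (S + total ordering)) (Σwt-↭ ordering-↭) ⟨
      2 * (Σwt ordering + total ordering)
        ≡⟨ swap (Σwt ordering) (total ordering) ⟩
      2 * total ordering + 2 * Σwt ordering
        ≤⟨ total-telescope first tail ordering-linked ⟩
      2 * (N * List.length tail) + (wt first + wt (lastOf first tail))
        ≡⟨ cong₂ (λ n e → 2 * (N * n) + e) length-tail ends ⟩
      2 * (N * N) + 2
        ≡⟨ *-distribˡ-+ 2 (N * N) 1 ⟨
      2 * (N * N + 1) ∎)
      where
      open ≤-Reasoning
      swap : ∀ a b → 2 * (a + b) ≡ 2 * b + 2 * a
      swap = solve-∀

    ordering-chromaticNumber : 1 ≤ l → HasChromaticNumber
    ordering-chromaticNumber 1≤l = chromaticNumber-from-bounds G (Σwt allVertices) (N * N + 1) (colors ordering)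
      (colors-hamiltonian 1≤l ordering ∈-ordering)
      (≤-trans (+-monoʳ-≤ (Σwt allVertices) (maxColor≤ G (colors ordering) (colors≤total ordering))) total-bound)
      (λ c hc → LowerBound.lower-bound {c} hc)

  -- The total weight

  opaque
    unfolding allVertices

    -- The legs with a fixed second index form a copy of the inner spine: `t` vertices with the same
    -- middle, each with an extra `2` for its height.
    Σwt-allVertices : Σwt allVertices ≡ spineSum t + 2 * suc t + l * (t * 2 + spineSum t)
    Σwt-allVertices = begin
      sum (map wt (spineVertices ++ legVertices))
        ≡⟨ cong sum (List.map-++ wt spineVertices legVertices) ⟩
      sum (map wt spineVertices ++ map wt legVertices)
        ≡⟨ sum-++ (map wt spineVertices) (map wt legVertices) ⟩
      Σwt spineVertices + Σwt legVertices
        ≡⟨ cong₂ _+_ spineΣ legΣ ⟩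
      spineSum t + 2 * suc t + l * (t * 2 + spineSum t) ∎
      where
      open ≡-Reasoning
      spineΣ : Σwt spineVertices ≡ spineSum t + 2 * suc t
      spineΣ = begin
        sum (map wt (map inj₁ (allFin (2 + t))))
          ≡⟨ cong sum (map-∘ {g = wt} {f = inj₁} (allFin (2 + t))) ⟨
        sum (map (wt ∘ inj₁) (allFin (2 + t)))
          ≡⟨ sum-allFin (2 + t) (λ i → ∣ suc (2 * i) - (2 + t) ∣) ⟩
        spineSum (2 + t)
          ≡⟨ spineSum-2+ t ⟩
        spineSum t + 2 * suc t ∎
      legWt : ℕ → ℕ
      legWt i = 2 + ∣ suc (2 * suc i) - (2 + t) ∣
      legΣ : Σwt legVertices ≡ l * (t * 2 + spineSum t)
      legΣ = begin
        sum (map wt (map inj₂ (cartesianProduct (allFin t) (allFin l))))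
          ≡⟨ cong sum (map-∘ {g = wt} {f = inj₂} (cartesianProduct (allFin t) (allFin l))) ⟨
        sum (map (legWt ∘ toℕ ∘ proj₁) (cartesianProduct (allFin t) (allFin l)))
          ≡⟨ sum-cartesianProduct (legWt ∘ toℕ) (allFin t) (allFin l) ⟩
        List.length (allFin l) * sum (map (legWt ∘ toℕ) (allFin t))
          ≡⟨ cong₂ _*_ (length-allFin l) (sum-allFin t legWt) ⟩
        l * sum (applyUpTo legWt t)
          ≡⟨ cong (l *_) (sum-applyUpTo-cong (λ i → cong (2 +_) (∣1+2[1+i]-2+n∣ i t)) t) ⟩
        l * sum (applyUpTo (λ i → 2 + ∣ suc (2 * i) - t ∣) t)
          ≡⟨ cong (l *_) (sum-applyUpTo-const+ 2 (λ i → ∣ suc (2 * i) - t ∣) t) ⟩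
        l * (t * 2 + spineSum t) ∎

  ∣n-1+n∣≡1 : ∀ n → ∣ n - suc n ∣ ≡ 1
  ∣n-1+n∣≡1 zero    = refl
  ∣n-1+n∣≡1 (suc n) = ∣n-1+n∣≡1 n

  -- The two ends of the ordering for even and odd spines

  module _ (s : ℕ) (t≡s+s : t ≡ s + s) (1≤l : 1 ≤ l) where
    -- Spine positions run from `0` to `suc (s + s)`, so the central edge joins positions `s` and
    -- `suc s`. Its endpoints are the ends of the ordering.
    chromaticNumber-even : HasChromaticNumber
    chromaticNumber-even = OptimalOrdering.ordering-chromaticNumber first final low
        (mirror-Low first low) adjacent first≢final (inj₁ refl) 1≤l
      where
      s≤t : s ≤ t
      s≤t = ≤-trans (m≤m+n s s) (≤-reflexive (sym t≡s+s))
      s<m : s < 2 + t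
      s<m = s≤s (m≤n⇒m≤1+n s≤t)
      first final : V
      first = inj₁ (fromℕ< s<m)
      final = mirror first
      pos-first : pos first ≡ s
      pos-first = toℕ-fromℕ< s<m
      pos-final : pos final ≡ suc s
      pos-final = +-cancelʳ-≡ s _ _
        (trans (cong (pos final +_) (sym pos-first)) (trans (pos-mirror first) (cong suc t≡s+s)))
      low : Low first
      low = begin
        suc (2 * pos first) ≡⟨ cong (λ n → suc (2 * n)) pos-first ⟩
        suc (s + (s + 0))   ≡⟨ cong (λ n → suc (s + n)) (+-identityʳ s) ⟩
        suc (s + s)         ≡⟨ cong suc t≡s+s ⟨
        suc t               ≤⟨ n≤1+n (suc t) ⟩
        2 + t               ∎
        where open ≤-Reasoning
      adjacent : dist first final ≡ 1
      adjacent = trans (cong₂ ∣_-_∣ pos-first pos-final) (∣n-1+n∣≡1 s)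
      first≢final : first ≢ final
      first≢final eq = 1+n≢n (trans (sym pos-final) (trans (cong pos (sym eq)) pos-first))

  module _ (s : ℕ) (t≡1+s+s : t ≡ suc (s + s)) (1≤l : 1 ≤ l) where
    -- The central spine vertex has position `suc s` and carries the legs with first index `s`. The
    -- ends of the ordering are this vertex and its first leg, which exists since `1 ≤ l`.
    chromaticNumber-odd : HasChromaticNumber
    chromaticNumber-odd = OptimalOrdering.ordering-chromaticNumber first final
        (≤-reflexive (middle first pos-first)) (≤-reflexive (sym (middle final pos-final))) adjacent (λ ())
        (inj₂ (≤-reflexive (sym (middle first pos-first)) , ≤-reflexive (middle final pos-final))) 1≤l
      where
      s<t : s < t
      s<t = ≤-trans (s≤s (m≤m+n s s)) (≤-reflexive (sym t≡1+s+s))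
      p : Fin t
      p = fromℕ< s<t
      first final : V
      first = inj₁ (attachment p)
      final = inj₂ (p , fromℕ< 1≤l)
      pos-final : pos final ≡ suc s
      pos-final = cong suc (toℕ-fromℕ< s<t)
      pos-first : pos first ≡ suc s
      pos-first = trans (toℕ-attachment p) pos-final
      double : ∀ n → suc (2 * suc n) ≡ 2 + suc (n + n)
      double = solve-∀
      middle : ∀ v → pos v ≡ suc s → suc (2 * pos v) ≡ 2 + t
      middle v pos≡ = trans (cong (λ n → suc (2 * n)) pos≡)
        (trans (double s) (cong (2 +_) (sym t≡1+s+s)))
      adjacent : dist first final ≡ 1
      adjacent = cong suc (trans (cong₂ ∣_-_∣ pos-first pos-final) (∣n-n∣≡0 (suc s)))

  chromaticNumber : 1 ≤ l → (∃[ s ] t ≡ s + s) ⊎ (∃[ s ] t ≡ suc (s + s)) → HasChromaticNumber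
  chromaticNumber 1≤l (inj₁ (s , t≡)) = chromaticNumber-even s t≡ 1≤l
  chromaticNumber 1≤l (inj₂ (s , t≡)) = chromaticNumber-odd s t≡ 1≤l

-- The closed formula over the integers and rationals

module ClosedForm where
  open import Data.Integer using (ℤ; +_; -_; _+_; _*_; _-_; _^_)
  open import Data.Integer.Properties using (pos-*)
  open import Data.Integer.Tactic.RingSolver using (solve-∀)
  open import Data.Nat as ℕ using (ℕ; suc)
  open import Data.Rational.Unnormalised
    using (_/_; _≃_; *≡*) renaming (_+_ to _⊕_; _-_ to _⊖_; _*_ to _⊛_)
  open import Relation.Binary.PropositionalEquality
    using (_≡_; refl; trans; cong; cong₂; module ≡-Reasoning)

  -- This is `N * N + 1` minus the total weight, with `S` standing for `spineSum t`.
  chromaticValue : ℤ → ℤ → ℤ → ℤ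
  chromaticValue t l S =
    (+ 1 + t + t * l) * (+ 1 + t + t * l) + + 1 - (S + + 2 * (+ 1 + t) + l * (t * + 2 + S))

  ℕ⇒chromaticValue : ∀ t l S h →
    (S ℕ.+ 2 ℕ.* suc t ℕ.+ l ℕ.* (t ℕ.* 2 ℕ.+ S)) ℕ.+ h
      ≡ (suc t ℕ.+ t ℕ.* l) ℕ.* (suc t ℕ.+ t ℕ.* l) ℕ.+ 1 →
    + h ≡ chromaticValue (+ t) (+ l) (+ S)
  ℕ⇒chromaticValue t l S h eq = begin
    + h                                ≡⟨ isolate (+ Σ) (+ h) ⟩
    + Σ + + h - + Σ                    ≡⟨⟩
    + (Σ ℕ.+ h) - + Σ                  ≡⟨ cong (λ n → + n - + Σ) eq ⟩
    + (N ℕ.* N) + + 1 - + Σ            ≡⟨ cong₂ (λ a b → a + + 1 - b) square weights ⟩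
    chromaticValue (+ t) (+ l) (+ S)   ∎
    where
    open ≡-Reasoning
    N Σ : ℕ
    N = suc t ℕ.+ t ℕ.* l
    Σ = S ℕ.+ 2 ℕ.* suc t ℕ.+ l ℕ.* (t ℕ.* 2 ℕ.+ S)
    isolate : ∀ a b → b ≡ a + b + - a
    isolate = solve-∀
    base : + N ≡ + 1 + + t + + t * + l
    base = cong (λ a → + 1 + + t + a) (pos-* t l)
    square : + (N ℕ.* N) ≡ (+ 1 + + t + + t * + l) * (+ 1 + + t + + t * + l)
    square = trans (pos-* N N) (cong₂ _*_ base base)
    weights : + Σ ≡ + S + + 2 * (+ 1 + + t) + + l * (+ t * + 2 + + S)
    weights = cong₂ (λ a b → + S + a + b) (pos-* 2 (suc t))
      (trans (pos-* l (t ℕ.* 2 ℕ.+ S)) (cong (λ a → + l * (a + + S)) (pos-* t 2)))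

  -- The identities below are the cross-multiplied equations, with powers and
  -- subtractions unfolded for the ring solver.
  formula-even : ∀ s l {M K H} → M ≡ + 2 + (s + s) → K ≡ + 2 + l →
    H ≡ chromaticValue (s + s) l (+ 2 * (s * s)) →
    H / 1 ≃ (((M - + 2) ^ 2 * K ^ 2) / 1
               ⊖ ((+ 5 * M ^ 2 - + 20 * M + + 20) / 2) ⊛ (K / 1))
               ⊕ ((+ 3 * M ^ 2 - + 12 * M + + 12) / 2)
  formula-even s l refl refl refl = *≡* (identity s l)
    where
    identity : ∀ s l →
      ((+ 1 + (s + s) + (s + s) * l) * (+ 1 + (s + s) + (s + s) * l) + + 1
        + - ((+ 2 * (s * s)) + + 2 * (+ 1 + (s + s)) + l * ((s + s) * + 2 + (+ 2 * (s * s))))) * + 4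
      ≡ (((((+ 2 + (s + s)) + - + 2) * (((+ 2 + (s + s)) + - + 2) * + 1))
            * ((+ 2 + l) * ((+ 2 + l) * + 1)) * + 2
          + - ((+ 5 * ((+ 2 + (s + s)) * ((+ 2 + (s + s)) * + 1))
              + - (+ 20 * (+ 2 + (s + s))) + + 20) * (+ 2 + l)) * + 1) * + 2
        + (+ 3 * ((+ 2 + (s + s)) * ((+ 2 + (s + s)) * + 1))
            + - (+ 12 * (+ 2 + (s + s))) + + 12) * + 2) * + 1
    identity = solve-∀

  formula-odd : ∀ s l {M K H} → M ≡ + 2 + (+ 1 + (s + s)) → K ≡ + 2 + l →
    H ≡ chromaticValue (+ 1 + (s + s)) l (+ 2 * (s * s + s)) →
    H / 1 ≃ (((M - + 2) ^ 2 * K ^ 2) / 1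
               ⊖ ((+ 5 * M ^ 2 - + 20 * M + + 19) / 2) ⊛ (K / 1))
               ⊕ ((+ 3 * M ^ 2 - + 12 * M + + 11) / 2)
  formula-odd s l refl refl refl = *≡* (identity s l)
    where
    identity : ∀ s l →
      ((+ 1 + (+ 1 + (s + s)) + (+ 1 + (s + s)) * l)
         * (+ 1 + (+ 1 + (s + s)) + (+ 1 + (s + s)) * l) + + 1
        + - ((+ 2 * (s * s + s)) + + 2 * (+ 1 + (+ 1 + (s + s)))
           + l * ((+ 1 + (s + s)) * + 2 + (+ 2 * (s * s + s))))) * + 4
      ≡ (((((+ 2 + (+ 1 + (s + s))) + - + 2) * (((+ 2 + (+ 1 + (s + s))) + - + 2) * + 1))
            * ((+ 2 + l) * ((+ 2 + l) * + 1)) * + 2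
          + - ((+ 5 * ((+ 2 + (+ 1 + (s + s))) * ((+ 2 + (+ 1 + (s + s))) * + 1))
              + - (+ 20 * (+ 2 + (+ 1 + (s + s)))) + + 19) * (+ 2 + l)) * + 1) * + 2
        + (+ 3 * ((+ 2 + (+ 1 + (s + s))) * ((+ 2 + (+ 1 + (s + s))) * + 1))
            + - (+ 12 * (+ 2 + (+ 1 + (s + s)))) + + 11) * + 2) * + 1
    identity = solve-∀

-- Parity of the spine length

module Parity where
  open import Data.Nat using (zero; suc; _+_; _*_)
  open import Data.Nat.Divisibility using (_∣_; divides)
  open import Data.Nat.Properties using (+-suc)
  open import Data.Nat.Tactic.RingSolver using (solve-∀)
  open import Data.Product using (∃-syntax; _,_)
  open import Data.Sum using (_⊎_; inj₁; inj₂)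
  open import Relation.Binary.PropositionalEquality using (_≡_; refl; sym; trans; cong)
  open import Relation.Nullary using (¬_; contradiction)

  even-or-odd : ∀ n → (∃[ s ] n ≡ s + s) ⊎ (∃[ s ] n ≡ suc (s + s))
  even-or-odd zero    = inj₁ (0 , refl)
  even-or-odd (suc n) with even-or-odd n
  ... | inj₁ (s , n≡) = inj₂ (s , cong suc n≡)
  ... | inj₂ (s , n≡) = inj₁ (suc s , trans (cong suc n≡) (cong suc (sym (+-suc s s))))

  2∣2+n⇒even : ∀ {n} → 2 ∣ suc (suc n) → ∃[ s ] n ≡ s + s
  2∣2+n⇒even (divides (suc q) refl) = q , double q
    where
    double : ∀ q → q * 2 ≡ q + q
    double = solve-∀

  2∤2+n⇒odd : ∀ {n} → ¬ 2 ∣ suc (suc n) → ∃[ s ] n ≡ suc (s + s)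
  2∤2+n⇒odd {n} 2∤2+n with even-or-odd n
  ... | inj₁ (s , refl) = contradiction (divides (suc s) (double s)) 2∤2+n
    where
    double : ∀ s → 2 + (s + s) ≡ suc s * 2
    double = solve-∀
  ... | inj₂ odd        = odd

-- The value of the chromatic number for both parities

open import Data.Integer using (+_; _+_; _*_; _-_; _^_)
open import Data.Integer.Properties using (pos-*)
open import Data.Nat as ℕ using (ℕ; suc; s≤s; _≤_)
open import Data.Nat.Divisibility using (_∣_)
open import Data.Product using (_×_; _,_; ∃-syntax)
open import Data.Rational.Unnormalised using (_/_; _≃_) renaming (_+_ to _⊕_; _-_ to _⊖_; _*_ to _⊛_)
open import Relation.Binary.PropositionalEquality using (_≡_; refl; sym; trans; cong)
open import Relation.Nullary using (¬_)

open CaterpillarOrdering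
open ClosedForm
open Parity

-- Keeping `T` and `S` as arbitrary integer expressions for `t` and `spineSum t` lets both parities
-- share one conversion from natural numbers.
value : ∀ t l {h T S} → Σwt t l (allVertices t l) ℕ.+ h ≡ N t l ℕ.* N t l ℕ.+ 1 →
  + t ≡ T → + spineSum t ≡ S → + h ≡ chromaticValue T (+ l) S
value t l {h} Σ+h≡ refl refl = ℕ⇒chromaticValue t l (spineSum t) h
  (trans (cong (ℕ._+ h) (sym (Σwt-allVertices t l))) Σ+h≡)

value-even : ∀ t l s {h} → t ≡ s ℕ.+ s →
  Σwt t l (allVertices t l) ℕ.+ h ≡ N t l ℕ.* N t l ℕ.+ 1 →
  + h ≡ chromaticValue (+ s + + s) (+ l) (+ 2 * (+ s * + s))
value-even t l s t≡ Σ+h≡ = value t l Σ+h≡ (cong +_ t≡)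
  (trans (cong +_ (trans (cong (spineSum) t≡) (spineSum-even s)))
    (trans (pos-* 2 (s ℕ.* s)) (cong (+ 2 *_) (pos-* s s))))

value-odd : ∀ t l s {h} → t ≡ suc (s ℕ.+ s) →
  Σwt t l (allVertices t l) ℕ.+ h ≡ N t l ℕ.* N t l ℕ.+ 1 →
  + h ≡ chromaticValue (+ 1 + (+ s + + s)) (+ l) (+ 2 * (+ s * + s + + s))
value-odd t l s t≡ Σ+h≡ = value t l Σ+h≡ (cong +_ t≡)
  (trans (cong +_ (trans (cong (spineSum) t≡) (spineSum-odd s)))
    (trans (pos-* 2 (s ℕ.* s ℕ.+ s)) (cong (λ a → + 2 * (a + + s)) (pos-* s s))))

theorem8 : (m k : ℕ) → 3 ≤ m → 3 ≤ k →
    let M = + m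
        K = + k
    in ∃[ h ] IsHamiltonianChromaticNumber (C m k) h
      × (¬ 2 ∣ m →
           + h / 1 ≃ (((M - + 2) ^ 2 * K ^ 2) / 1
                      ⊖ ((+ 5 * M ^ 2 - + 20 * M + + 19) / 2) ⊛ (K / 1))
                      ⊕ ((+ 3 * M ^ 2 - + 12 * M + + 11) / 2))
      × (2 ∣ m →
           + h / 1 ≃ (((M - + 2) ^ 2 * K ^ 2) / 1
                      ⊖ ((+ 5 * M ^ 2 - + 20 * M + + 20) / 2) ⊛ (K / 1))
                      ⊕ ((+ 3 * M ^ 2 - + 12 * M + + 12) / 2))
-- With `m = 2 + t` and `k = 2 + l`, the bound `3 ≤ k` becomes `1 ≤ l`.
theorem8 (suc (suc t)) (suc (suc l)) (s≤s (s≤s _)) (s≤s (s≤s 1≤l)) =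
  -- The equation `Σ+h≡` has the same form for both parities, so a single `h` serves both formulas;
  -- they differ through `spineSum t`.
  let h , hcn , Σ+h≡ = chromaticNumber t l 1≤l (even-or-odd t) in
  h , hcn
  , (λ 2∤m → let s , t≡ = 2∤2+n⇒odd 2∤m in
      formula-odd (+ s) (+ l) {+ (2 ℕ.+ t)} {+ (2 ℕ.+ l)} {+ h}
        (cong (λ n → + (2 ℕ.+ n)) t≡) refl (value-odd t l s t≡ Σ+h≡))
  , (λ 2∣m → let s , t≡ = 2∣2+n⇒even 2∣m in
      formula-even (+ s) (+ l) {+ (2 ℕ.+ t)} {+ (2 ℕ.+ l)} {+ h}
        (cong (λ n → + (2 ℕ.+ n)) t≡) refl (value-even t l s t≡ Σ+h≡))
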